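{- There is an absolute constant $C>0$ such that the following holds. Fix a sequence of real numbers $(\alpha_k)_{k\ge 0}$ with $\alpha_k\ge 1$ for all $k$. Let $\mathcal{A}$ be any one of the three greedy algorithms $\mathrm{Greedy}_1,\mathrm{Greedy}_2,\mathrm{Greedy}_3$, running on an instance $\mathcal{I}$ of online Steiner Forest with $k\ge 3$ pairs. Then $$\mathrm{cost}_{\mathcal{A}}\left(\mathcal{I},\mathcal{P}_{<\alpha_k}\right)\le C\cdot\log(k)\cdot\left(\log(\alpha_k)+\log\log(k)\right)\cdot w(\mathrm{OPT}(\mathcal{I})).$$
   Context: Logarithms are in base 2. Online Steiner Forest. An instance $\mathcal{I}$ consists of a finite undirected weighted graph $G=(V,E,w)$ with $w:E\to\mathbb{R}_{\ge 0}$ and an ordered sequence $\mathcal{P}=(p_1,\dots,p_k)$ of pairs $p_i=\{s_i,t_i\}$ of vertices (lying in the same connected component of $G$), revealed one by one. $w(\mathrm{OPT}(\mathcal{I}))$ is the minimum total weight of a subgraph (forest) of $G$ in which $s_i$ and $t_i$ are connected for every $i$. The vertices appearing in some pair are called terminals. Greedy algorithms. The algorithm maintains graphs $G^{(\tau)}=(V,E\cup S^{(\tau)})$, where $S^{(0)}=\emptyset$ and $S^{(0)}\subseteq S^{(1)}\subseteq\cdots\subseteq S^{(k)}$ are sets of edges of weight $0$ on $V$ called shortcuts. When pair $p_{\tau+1}=\{s,t\}$ arrives, the algorithm takes a shortest $s$–$t$ path $s=v_0,v_1,\dots,v_\ell,v_{\ell+1}=t$ in $G^{(\tau)}$ (ties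 broken arbitrarily) and pays $\mathrm{cost}_{\mathcal{A}}(\mathcal{I},p_{\tau+1})=d_{G^{(\tau)}}(s,t)$, its length. Then $S^{(\tau+1)}$ is obtained from $S^{(\tau)}$ by adding shortcuts as follows, $\mathrm{Greedy}_i$ using Rule $i$: - Rule 1: add a weight-0 edge $\{v_j,v_{j+1}\}$ for all $0\le j\le \ell$. - Rule 2: add a single weight-0 edge $\{s,t\}$. - Rule 3: let $s=v'_0,v'_1,\dots,v'_{\ell'},v'_{\ell'+1}=t$ be the subsequence of the path consisting of $s$, $t$ and those path vertices that appeared in a previously arrived pair; add a weight-0 edge $\{v'_j,v'_{j+1}\}$ for all $0\le j\le\ell'$. Contraction. The contraction of a pair $p=\{s,t\}$ is $\alpha(p)=d_G(s,t)/\mathrm{cost}_{\mathcal{A}}(\mathcal{I},p)$ (distance in the original graph $G$), with $\alpha(p)=\infty$ if $\mathrm{cost}_{\mathcal{A}}(\mathcal{I},p)=0$. For $\alpha\ge1$, $\mathcal{P}_{<\alpha}$ is the set of pairs $p\in\mathcal{P}$ with $\alpha(p)<\alpha$. For $S\subseteq\mathcal{P}$, $\mathrm{cost}_{\mathcal{A}}(\mathcal{I},S)=\sum_{p\in S}\mathrm{cost}_{\mathcal{A}}(\mathcal{I},p)$. -}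

module Defs where

open import Level using (0ℓ)
open import Algebra.Bundles using (CommutativeRing)
import Algebra.Properties.Semiring.Mult as SemiringMult
open import Data.Fin.Base using (Fin; zero; suc)
open import Data.Fin.Properties using (_≟_)
open import Data.List.Base using (List; []; _∷_; _++_; [_]; map; foldr; filter; zip; drop; allFin)
open import Data.List.Membership.Propositional using (_∈_)
open import Data.List.Relation.Binary.Sublist.Propositional using (_⊆_)
open import Data.List.Relation.Unary.Any using (Any; any?)
open import Data.List.Relation.Unary.Unique.Propositional using (Unique)
open import Data.Nat.Base using (ℕ)
open import Data.Product.Base using (Σ; ∃; _×_; _,_; proj₁; proj₂; uncurry)
open import Data.Sum.Base using (_⊎_)
open import Data.Vec.Base as Vec using (Vec)
open import Relation.Binary.Core using (Rel)
open import Relation.Binary.Definitions using (Decidable)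
open import Relation.Binary.PropositionalEquality.Core using (_≡_)
open import Relation.Binary.Structures using (IsDecTotalOrder)
import Relation.Binary.Construct.NonStrictToStrict as NonStrictToStrict
import Relation.Binary.Construct.Add.Supremum.Strict as AddSupremumStrict
open import Relation.Nullary.Construct.Add.Supremum using (_⁺; ⊤⁺) renaming ([_] to fin⁺)
open import Relation.Nullary.Decidable.Core using (yes; no; _⊎-dec_)
open import Relation.Nullary.Negation.Core using (¬_)

module Bounds {A : Set} (_≤_ : Rel A 0ℓ) where

  IsUpperBound IsLowerBound IsSupremum IsInfimum : (A → Set) → A → Set
  IsUpperBound P b = ∀ x → P x → x ≤ b
  IsLowerBound P b = ∀ x → P x → b ≤ x
  IsSupremum   P b = IsUpperBound P b × (∀ c → IsUpperBound P c → b ≤ c)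
  IsInfimum    P b = IsLowerBound P b × (∀ c → IsLowerBound P c → c ≤ b)

-- The classical characterisation of ℝ: a Dedekind-complete totally
-- ordered field.  Classically it has exactly one model up to isomorphism.
-- Decidability of the order, which excludes intuitionistic models, makes
-- ℝ classical, so that sums over {p | α(p) < α} can be formed.

record RealNumbers : Set₁ where
  infix 4 _≤_
  field
    commutativeRing : CommutativeRing 0ℓ 0ℓ

  open CommutativeRing commutativeRing public
    using (Carrier; _≈_; _+_; _*_; -_; 0#; 1#)
  module Ring = CommutativeRing commutativeRing

  field
    0≉1             : ¬ (0# ≈ 1#)
    invertible      : ∀ x → ¬ (x ≈ 0#) → ∃ λ y → x * y ≈ 1#
    _≤_             : Rel Carrier 0ℓ
    isDecTotalOrder : IsDecTotalOrder _≈_ _≤_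
    +-monoʳ-≤       : ∀ z {x y} → x ≤ y → z + x ≤ z + y
    *-nonNegative   : ∀ {x y} → 0# ≤ x → 0# ≤ y → 0# ≤ x * y

  module Order = IsDecTotalOrder isDecTotalOrder

  open Bounds _≤_ public

  field
    complete : (P : Carrier → Set) → ∃ P → ∃ (IsUpperBound P) → ∃ (IsSupremum P)

  open NonStrictToStrict _≈_ _≤_ public using (_<_; <-decidable)

  _<?_ : Decidable _<_
  _<?_ = <-decidable Order._≟_ Order._≤?_

  fromℕ : ℕ → Carrier
  fromℕ n = n · 1#
    where open SemiringMult Ring.semiring using () renaming (_×_ to _·_)

  ∑ : List Carrier → Carrier
  ∑ = foldr _+_ 0#

  divide : (x y : Carrier) → ¬ (y ≈ 0#) → Carrier
  divide x y y≉0 = x * proj₁ (invertible y y≉0)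

  -- The infimum is obtained as the supremum of the set of lower bounds.
  infimum : (P : Carrier → Set) → ∃ P → ∃ (IsLowerBound P) → ∃ (IsInfimum P)
  infimum P (x , Px) bounded with complete (IsLowerBound P) bounded (x , λ _ l → l x Px)
  ... | b , upper , least = b , (λ y Py → least y (λ _ l → l y Py)) , upper

-- The base-2 logarithm is the unique increasing homomorphism from the
-- multiplicative group of positive reals to the additive group of reals
-- sending 2 to 1.  Values at non-positive arguments are unconstrained.

record IsLog₂ (ℝ : RealNumbers) (log : RealNumbers.Carrier ℝ → RealNumbers.Carrier ℝ) : Set where
  open RealNumbers ℝ
  field
    log-*      : ∀ {x y} → 0# < x → 0# < y → log (x * y) ≈ log x + log y
    log-mono-≤ : ∀ {x y} → 0# < x → x ≤ y → log x ≤ log y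
    log-2      : log (fromℕ 2) ≈ 1#

data Greedy : Set where
  greedy₁ greedy₂ greedy₃ : Greedy

Pair : ℕ → Set
Pair n = Fin n × Fin n

consecutive : {A : Set} → List A → List (A × A)
consecutive vs = zip vs (drop 1 vs)

-- 'arrived' lists the pairs revealed before {s , t}, and 'vs' is the
-- vertex sequence, endpoints included, of the chosen s–t path.
newShortcuts : ∀ {n} → Greedy → (arrived : List (Pair n)) (s t : Fin n) (vs : List (Fin n)) →
               List (Pair n)
newShortcuts greedy₁ arrived s t vs = consecutive vs
newShortcuts greedy₂ arrived s t vs = [ (s , t) ]
newShortcuts {n} greedy₃ arrived s t vs = consecutive (filter keep? vs)
  where
  Keep : Fin n → Set
  Keep v = (v ≡ s ⊎ v ≡ t) ⊎ Any (λ p → v ≡ proj₁ p ⊎ v ≡ proj₂ p) arrived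

  keep? = λ (v : Fin n) →
    ((v ≟ s) ⊎-dec (v ≟ t)) ⊎-dec any? (λ p → (v ≟ proj₁ p) ⊎-dec (v ≟ proj₂ p)) arrived

module SteinerForest (ℝ : RealNumbers) where
  open RealNumbers ℝ
  open AddSupremumStrict _<_ public using (_<⁺_; <⁺-dec)

  -- The order of the two ends is immaterial, see 'Joins'.
  record Edge (n : ℕ) : Set where
    constructor edge
    field
      end₁ end₂ : Fin n
      weight    : Carrier
      0≤weight  : 0# ≤ weight

  -- A graph on the vertex set Fin n is given by its list of edges;
  -- parallel edges and loops are allowed.
  Graph : ℕ → Set
  Graph n = List (Edge n)

  totalWeight : ∀ {n} → Graph n → Carrier
  totalWeight G = ∑ (map Edge.weight G)

  Joins : ∀ {n} → Edge n → Fin n → Fin n → Set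
  Joins e u v = (Edge.end₁ e ≡ u × Edge.end₂ e ≡ v) ⊎ (Edge.end₁ e ≡ v × Edge.end₂ e ≡ u)

  data Walk {n} (G : Graph n) : Fin n → Fin n → Set where
    stop : ∀ {v} → Walk G v v
    step : ∀ {u v t} (e : Edge n) → e ∈ G → Joins e u v → Walk G v t → Walk G u t

  module _ {n} {G : Graph n} where

    vertices : ∀ {s t} → Walk G s t → List (Fin n)
    vertices (stop {v})               = [ v ]
    vertices (step {u = u} _ _ _ rest) = u ∷ vertices rest

    walkLength : ∀ {s t} → Walk G s t → Carrier
    walkLength stop              = 0#
    walkLength (step e _ _ rest) = Edge.weight e + walkLength rest

    0≤walkLength : ∀ {s t} (π : Walk G s t) → 0# ≤ walkLength π
    0≤walkLength stop              = Order.refl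
    0≤walkLength (step e _ _ rest) =
      Order.trans (Edge.0≤weight e)
        (Order.trans (Order.reflexive (Ring.sym (Ring.+-identityʳ (Edge.weight e))))
                     (+-monoʳ-≤ (Edge.weight e) (0≤walkLength rest)))

  Path : ∀ {n} → Graph n → Fin n → Fin n → Set
  Path G s t = Σ (Walk G s t) λ π → Unique (vertices π)

  pathLength : ∀ {n} {G : Graph n} {s t} → Path G s t → Carrier
  pathLength (π , _) = walkLength π

  IsShortest : ∀ {n} {G : Graph n} {s t} → Path G s t → Set
  IsShortest {G = G} {s} {t} π = (π′ : Path G s t) → pathLength π ≤ pathLength π′

  IsPathLength : ∀ {n} → Graph n → (s t : Fin n) → Carrier → Set
  IsPathLength G s t x = Σ (Path G s t) λ π → pathLength π ≈ x

  -- The infimum ranges over finitely many lengths, so it is a minimum.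
  -- The path argument only witnesses that s and t are connected.
  distance : ∀ {n} (G : Graph n) {s t} → Path G s t → Carrier
  distance G {s} {t} π = proj₁ (infimum (IsPathLength G s t) (pathLength π , π , Ring.refl)
    (0# , λ x (π′ , eq) → Order.trans (0≤walkLength (proj₁ π′)) (Order.reflexive eq)))

  _∪shortcuts_ : ∀ {n} → Graph n → List (Pair n) → Graph n
  G ∪shortcuts S = G ++ map (λ (u , v) → edge u v 0# Order.refl) S

  record Instance (k : ℕ) : Set where
    field
      n         : ℕ
      G         : Graph n
      pairs     : Vec (Pair n) k
      connected : ∀ i → uncurry (Path G) (Vec.lookup pairs i)

  module _ {k : ℕ} (ℐ : Instance k) where
    open Instance ℐ

    Feasible : Graph n → Set
    Feasible F = F ⊆ G × (∀ i → uncurry (Path F) (Vec.lookup pairs i))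

    IsOPT : Graph n → Set
    IsOPT F = Feasible F × (∀ F′ → Feasible F′ → totalWeight F ≤ totalWeight F′)

  -- 'Execution 𝒜 G arrived S ps' is an execution of the remaining requests
  -- 'ps', started when the pairs in 'arrived' have already been served and
  -- the shortcuts in S have been added.  Ties between shortest paths are
  -- broken arbitrarily: any shortest path may be chosen in a step.
  data Execution {n} (𝒜 : Greedy) (G : Graph n) (arrived S : List (Pair n)) :
                 ∀ {k} → Vec (Pair n) k → Set where
    done  : Execution 𝒜 G arrived S Vec.[]
    serve : ∀ {k s t} {ps : Vec (Pair n) k}
            (π : Path (G ∪shortcuts S) s t) → IsShortest π →
            Execution 𝒜 G ((s , t) ∷ arrived)
              (S ++ newShortcuts 𝒜 arrived s t (vertices (proj₁ π))) ps →
            Execution 𝒜 G arrived S ((s , t) Vec.∷ ps)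

  Run : ∀ {k} → Greedy → Instance k → Set
  Run 𝒜 ℐ = Execution 𝒜 G [] [] pairs
    where open Instance ℐ

  -- The length of a shortest path is d_{G^(τ)}(s , t).
  stepCost : ∀ {n 𝒜} {G : Graph n} {arrived S k} {ps : Vec (Pair n) k} →
             Execution 𝒜 G arrived S ps → Fin k → Carrier
  stepCost (serve π _ _)    zero    = pathLength π
  stepCost (serve _ _ rest) (suc i) = stepCost rest i

  -- Pairs are referred to by their position in the request sequence, and
  -- 'Carrier ⁺' is ℝ ∪ {∞}.
  module _ {k : ℕ} {𝒜 : Greedy} (ℐ : Instance k) (run : Run 𝒜 ℐ) where
    open Instance ℐ

    contraction : Fin k → Carrier ⁺
    contraction i with stepCost run i Order.≟ 0#
    ... | yes _      = ⊤⁺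
    ... | no  cost≉0 = fin⁺ (divide (distance G (connected i)) (stepCost run i) cost≉0)

    pairsBelow : Carrier → List (Fin k)
    pairsBelow α = filter (λ i → <⁺-dec _<?_ (contraction i) (fin⁺ α)) (allFin k)

    cost : List (Fin k) → Carrier
    cost is = ∑ (map (stepCost run) is)

{-# OPTIONS --safe #-}
module Submission where

open import Defs
import Algebra.Properties.CommutativeMonoid.Mult as CommutativeMonoidMult
import Algebra.Properties.Semiring.Mult as SemiringMult
import Algebra.Solver.Ring.NaturalCoefficients.Default as SemiringSolver
open import Data.Bool.Base using (Bool; true; false; not)
open import Data.Empty using (⊥)
open import Data.Fin.Base as Fin using (Fin; toℕ; zero; suc)
open import Data.Fin.Properties using (toℕ-injective; toℕ<n; _≟_)
open import Data.List.Base using (List; []; _∷_; _++_; map; filter; length; allFin; [_])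
import Data.List.Membership.DecPropositional
open import Data.List.Membership.Propositional using (_∈_; _∉_; find; lose)
open import Data.List.Membership.Propositional.Properties using (∈-++⁺ˡ; ∈-++⁺ʳ; ∈-++⁻; ∈-filter⁺; ∈-length; ∈-map⁺; ∈-allFin)
open import Data.List.Properties using (length-++; length-filter; length-tabulate)
import Data.List.Relation.Binary.Sublist.Propositional as Sublist
open import Data.List.Relation.Unary.All as All using (All; []; _∷_)
import Data.List.Relation.Unary.All.Properties as Allₚ
open import Data.List.Relation.Unary.AllPairs as AllPairs using (AllPairs; []; _∷_)
import Data.List.Relation.Unary.AllPairs.Properties as AllPairsₚ
open import Data.List.Relation.Unary.Any using (here; there; Any; any?)
open import Data.List.Relation.Unary.Unique.Propositional using (Unique)
import Data.List.Relation.Unary.Unique.Propositional.Properties as Uniqueₚ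
open import Data.Nat.Base as ℕ using (ℕ; zero; suc; z≤n; s≤s; s≤s⁻¹)
import Data.Nat.Properties as ℕₚ
open import Data.Nat.Tactic.RingSolver using (solve-∀)
open import Data.Product.Base using (Σ; ∃; _×_; _,_; proj₁; proj₂; ∃₂; uncurry)
open import Data.Sum.Base using (_⊎_; inj₁; inj₂)
open import Data.Vec.Base as Vec using (Vec)
open import Function.Base using (_∘_; id)
open import Level using (0ℓ)
open import Relation.Binary.Bundles using (Poset)
import Relation.Binary.Construct.Add.Supremum.Strict as AddSupremumStrict
open import Relation.Binary.Construct.Closure.ReflexiveTransitive as Star using (Star; _◅_) renaming (ε to ε⋆)
import Relation.Binary.Construct.NonStrictToStrict as Strict
open import Relation.Binary.PropositionalEquality.Core as ≡ using (_≡_; refl; _≢_)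
import Relation.Binary.Reasoning.PartialOrder as PartialOrderReasoning
open import Relation.Nullary.Construct.Add.Supremum using () renaming ([_] to fin⁺)
open import Relation.Nullary.Decidable.Core using (Dec; yes; no; decidable-stable; ¬?)
open import Relation.Nullary.Negation.Core using (¬_; contradiction)
open import Relation.Unary using (Decidable)

-- Let every vertex carry the weight of the edges of OPT at it, with total mass W = 2 w(OPT), and let
-- d be the distance in G.  Greediness means that a pair costs at most the total length of the
-- gaps in any chain of earlier pairs between its ends, and a ball of radius ρ ≤ cost(p) around an
-- end of p has mass at least ρ, because OPT leaves it.
--
-- Fix a dyadic cost level c and a dyadic number g, and consider the pairs of P_{<α} with cost about c
-- whose balls of radius R = c · poly(α, log k) have mass about c · 2 ^ g.  Identifying vertices at
-- distance at most 2ε, where ε ~ c / g, these pairs form a graph of girth Ω(g) in which every ball of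
-- g steps has fewer than 2 ^ O(g) vertices.  Growing balls until they stop doubling therefore yields
-- endpoints with disjoint ε-balls, half as many as there are pairs.  An ε-ball of mass at least c
-- pays for its pair at rate 1.  A lighter one pays at rate c / ε ~ g; but then at each of its points
-- the logarithm of the mass grows by Ω(g) between the radii c / polylog(k) and 2R.  For a fixed point
-- the rates sum over the dyadic values of g to a geometric series, and over the O(log k) levels c the
-- growth telescopes to O(log k · log (R / c)), with log (R / c) = O(log α + log log k).

-- The choice of ε is a trade-off: closed chains are excluded for about c / ε steps, which favours a
-- small ε, while a light ball has to pay at rate c / ε, which favours a large one. Packing decides:
-- every ε-ball around an endpoint has mass at least ε, so a region of mass c · 2 ^ g holds at most
-- about (c / ε) · 2 ^ g separated endpoints. For ε ~ c / g this is g · 2 ^ g, less than a ball that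
-- doubles for 2g steps would contain, and 2g steps are still within the girth. The bound α(p) < α
-- is what ties the graph of pairs to the metric of G: one step of ball growing crosses a pair and
-- may move by d(s,t) ≤ α · cost(p). Hence g steps stay within radius R, where the mass is known.

module Naturals where
  open import Data.Nat.Base as ℕ using (ℕ; zero; suc; _+_; _*_; _^_; _∸_; _≤_; _<_; z≤n; s≤s; s≤s⁻¹)
  open import Data.Nat.Properties
  open import Data.Nat.Tactic.RingSolver using (solve-∀)
  open import Data.Product.Base using (_×_; _,_; proj₁; proj₂)
  open import Relation.Binary.PropositionalEquality.Core using (_≡_; refl; cong; cong₂; sym; trans)
  open import Relation.Nullary.Decidable.Core using (yes; no)
  open import Relation.Nullary.Negation.Core using (contradiction)

  open ≤-Reasoning

  -- Finite sums of natural numbers and the inequalities between the parameters.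

  sumTo : ℕ → (ℕ → ℕ) → ℕ
  sumTo zero    f = 0
  sumTo (suc n) f = f n + sumTo n f

  sumTo-mono-≤ : ∀ n {f g} → (∀ i → i < n → f i ≤ g i) → sumTo n f ≤ sumTo n g
  sumTo-mono-≤ zero    _ = z≤n
  sumTo-mono-≤ (suc n) p = +-mono-≤ (p n ≤-refl) (sumTo-mono-≤ n (λ i i<n → p i (m≤n⇒m≤1+n i<n)))

  sumTo-const : ∀ n z → sumTo n (λ _ → z) ≡ n * z
  sumTo-const zero    z = refl
  sumTo-const (suc n) z = cong (z +_) (sumTo-const n z)

  sumTo-+ : ∀ n f g → sumTo n (λ i → f i + g i) ≡ sumTo n f + sumTo n g
  sumTo-+ zero    f g = refl
  sumTo-+ (suc n) f g rewrite sumTo-+ n f g = rearrange (f n) (g n) (sumTo n f) (sumTo n g)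
    where
    rearrange : ∀ a b c d → a + b + (c + d) ≡ a + c + (b + d)
    rearrange = solve-∀

  sumTo-* : ∀ n z f → sumTo n (λ i → z * f i) ≡ z * sumTo n f
  sumTo-* zero    z f = sym (*-zeroʳ z)
  sumTo-* (suc n) z f rewrite sumTo-* n z f = sym (*-distribˡ-+ z (f n) (sumTo n f))

  ∸-triangle : ∀ m n o → m ∸ o ≤ (m ∸ n) + (n ∸ o)
  ∸-triangle m n o = m≤n+o⇒m∸n≤o m o (begin
    m                           ≤⟨ m≤n+m∸n m n ⟩
    n + (m ∸ n)                 ≤⟨ +-monoˡ-≤ (m ∸ n) (m≤n+m∸n n o) ⟩
    o + (n ∸ o) + (m ∸ n)       ≡⟨ rearrange o (n ∸ o) (m ∸ n) ⟩
    o + ((m ∸ n) + (n ∸ o))     ∎)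
    where
    rearrange : ∀ a b c → a + b + c ≡ a + (c + b)
    rearrange = solve-∀

  module _ {f : ℕ → ℕ} (mono : ∀ i → f i ≤ f (suc i)) {M : ℕ} (bound : ∀ i → f i ≤ M) where

    sumTo-step : ∀ n i → sumTo n (λ j → f (suc j + i) ∸ f (j + i)) ≤ f (n + i)
    sumTo-step zero    i = z≤n
    sumTo-step (suc n) i = begin
      (f (suc n + i) ∸ f (n + i)) + sumTo n _ ≤⟨ +-monoʳ-≤ _ (sumTo-step n i) ⟩
      (f (suc n + i) ∸ f (n + i)) + f (n + i) ≡⟨ m∸n+n≡m (mono (n + i)) ⟩
      f (suc n + i)                           ∎

    -- A `w`-step increment splits into `w` one-step increments, and for each fixed offset the
    -- one-step increments telescope to at most `M`.
    sumTo-telescope : ∀ w n → sumTo n (λ j → f (j + w) ∸ f j) ≤ w * M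
    sumTo-telescope zero n = begin
      sumTo n (λ j → f (j + 0) ∸ f j)
        ≤⟨ sumTo-mono-≤ n (λ j _ → ≤-reflexive (trans (cong (λ i → f i ∸ f j) (+-identityʳ j)) (n∸n≡0 (f j)))) ⟩
      sumTo n (λ _ → 0)                ≡⟨ trans (sumTo-const n 0) (*-zeroʳ n) ⟩
      0                                ∎
    sumTo-telescope (suc w) n = begin
      sumTo n (λ j → f (j + suc w) ∸ f j)
        ≤⟨ sumTo-mono-≤ n (λ j _ → ≤-trans (≤-reflexive (cong (λ i → f i ∸ f j) (+-suc j w)))
             (∸-triangle (f (suc j + w)) (f (j + w)) (f j))) ⟩
      sumTo n (λ j → (f (suc j + w) ∸ f (j + w)) + (f (j + w) ∸ f j))
        ≡⟨ sumTo-+ n _ _ ⟩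
      sumTo n (λ j → f (suc j + w) ∸ f (j + w)) + sumTo n (λ j → f (j + w) ∸ f j)
        ≤⟨ +-mono-≤ (≤-trans (sumTo-step n w) (bound (n + w))) (sumTo-telescope w n) ⟩
      M + w * M ∎

  truncated : ℕ → ℕ → ℕ
  truncated D b with 2 ^ b ≤? D
  ... | yes _ = 2 ^ b
  ... | no  _ = 0

  truncated-≤ : ∀ {D b} → 2 ^ b ≤ D → truncated D b ≡ 2 ^ b
  truncated-≤ {D} {b} p with 2 ^ b ≤? D
  ... | yes _ = refl
  ... | no ¬p = contradiction p ¬p

  -- The two bounds feed each other: while `2 ^ n ≤ D` the new term dominates all earlier ones by
  -- the first bound, which gives the second; afterwards the terms vanish.
  sumTo-truncated : ∀ D n → sumTo n (truncated D) ≤ 2 ^ n × sumTo n (truncated D) ≤ 2 * D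
  sumTo-truncated D zero    = z≤n , z≤n
  sumTo-truncated D (suc n) with 2 ^ n ≤? D | sumTo-truncated D n
  ... | yes 2^n≤D | ih , _ = doubled , ≤-trans doubled (*-monoʳ-≤ 2 2^n≤D)
    where
    doubled : 2 ^ n + sumTo n (truncated D) ≤ 2 * 2 ^ n
    doubled = +-monoʳ-≤ (2 ^ n) (≤-trans ih (m≤m+n (2 ^ n) 0))
  ... | no  _     | ih , ih′ = ≤-trans ih (m≤m+n (2 ^ n) _) , ih′

  b+7<2^[b+3] : ∀ b → b + 7 < 2 ^ (b + 3)
  b+7<2^[b+3] zero    = ≤-refl
  b+7<2^[b+3] (suc b) = begin-strict
    suc b + 7                 <⟨ s≤s (b+7<2^[b+3] b) ⟩
    1 + 2 ^ (b + 3)           ≤⟨ +-monoˡ-≤ (2 ^ (b + 3)) (m^n>0 2 (b + 3)) ⟩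
    2 ^ (b + 3) + 2 ^ (b + 3) ≤⟨ +-monoʳ-≤ (2 ^ (b + 3)) (m≤m+n _ 0) ⟩
    2 ^ (suc b + 3)           ∎

  -- The thresholds increase with the exponent, so this downward search ends at the least `b ≤ B`
  -- with `h ≤ 2 ^ (b + 3)`, provided that `B` itself qualifies.
  least : ℕ → ℕ → ℕ
  least h zero    = 0
  least h (suc B) with h ≤? 2 ^ (B + 3)
  ... | yes _ = least h B
  ... | no  _ = suc B

  least-≤ : ∀ h B → least h B ≤ B
  least-≤ h zero    = z≤n
  least-≤ h (suc B) with h ≤? 2 ^ (B + 3)
  ... | yes _ = m≤n⇒m≤1+n (least-≤ h B)
  ... | no  _ = ≤-refl

  least-qualifies : ∀ h B → h ≤ 2 ^ (B + 3) → h ≤ 2 ^ (least h B + 3)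
  least-qualifies h zero    p = p
  least-qualifies h (suc B) p with h ≤? 2 ^ (B + 3)
  ... | yes q = least-qualifies h B q
  ... | no  _ = p

  least-minimal : ∀ h B {b} → least h B ≡ suc b → 2 ^ (b + 3) < h
  least-minimal h (suc B) eq with h ≤? 2 ^ (B + 3)
  ... | yes _ = least-minimal h B eq
  least-minimal h (suc B) refl | no ¬p = ≰⇒> ¬p

  1≤2^ : ∀ n → 1 ≤ 2 ^ n
  1≤2^ n = m^n>0 2 n

  2^-+ : ∀ a b → 2 ^ (a + b) ≡ 2 ^ a * 2 ^ b
  2^-+ = ^-distribˡ-+-* 2

  2^-mono : ∀ {a b} → a ≤ b → 2 ^ a ≤ 2 ^ b
  2^-mono = ^-monoʳ-≤ 2

  -- In units of ε/2, the left side is L · ε with L = 4g + 2 and g = 2 ^ (b + 4), and the right side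
  -- is the cost level. Closed chains of L steps are therefore too short for greediness.
  cycle-shorter : ∀ b → (4 * 2 ^ (b + 4) + 2) * 2 < 2 ^ (b + 8)
  cycle-shorter b rewrite 2^-+ b 4 | 2^-+ b 8 = begin-strict
    (4 * (x * 16) + 2) * 2  ≡⟨ left x ⟩
    128 * x + 4             <⟨ +-monoʳ-< (128 * x) (≤-trans (m≤m+n 5 123) (*-monoʳ-≤ 128 (1≤2^ b))) ⟩
    128 * x + 128 * x       ≡⟨ right x ⟩
    x * 256                 ∎
    where
    x = 2 ^ b
    left : ∀ x → (4 * (x * 16) + 2) * 2 ≡ 128 * x + 4
    left = solve-∀
    right : ∀ x → 128 * x + 128 * x ≡ x * 256
    right = solve-∀

  -- In units of ε/2, `g` strides of ball growing plus a final ε fit into the radius R.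
  strides-fit : ∀ A {b B} → b ≤ B → 2 ^ (b + 4) * (4 + 2 ^ (A + (b + 9))) + 2 ≤ 2 ^ (B + A + (b + 14))
  strides-fit A {b} {B} b≤B
    rewrite 2^-+ (B + A) (b + 14) | 2^-+ B A | 2^-+ A (b + 9) | 2^-+ b 14 | 2^-+ b 9 | 2^-+ b 4 = begin
    x * 16 * (4 + y * (x * 512)) + 2     ≡⟨ left x y ⟩
    64 * x + 8192 * (x * x * y) + 2 * 1
      ≤⟨ +-mono-≤ (+-monoˡ-≤ (8192 * (x * x * y)) (*-monoʳ-≤ 64 x≤xxy)) (*-monoʳ-≤ 2 (≤-trans (1≤2^ b) x≤xxy)) ⟩
    64 * (x * x * y) + 8192 * (x * x * y) + 2 * (x * x * y) ≡⟨ middle (x * x * y) ⟩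
    8258 * (x * x * y)
      ≤⟨ *-mono-≤ (m≤m+n 8258 8126) (*-monoˡ-≤ y (*-monoˡ-≤ x (2^-mono b≤B))) ⟩
    16384 * (2 ^ B * x * y)              ≡⟨ right x y (2 ^ B) ⟩
    2 ^ B * y * (x * 16384)              ∎
    where
    x = 2 ^ b
    y = 2 ^ A
    x≤xxy : x ≤ x * x * y
    x≤xxy = begin
      x          ≡⟨ trans (*-identityʳ (x * 1)) (*-identityʳ x) ⟨
      x * 1 * 1  ≤⟨ *-mono-≤ (*-monoʳ-≤ x (1≤2^ b)) (1≤2^ A) ⟩
      x * x * y  ∎
    left : ∀ x y → x * 16 * (4 + y * (x * 512)) + 2 ≡ 64 * x + 8192 * (x * x * y) + 2 * 1
    left = solve-∀
    middle : ∀ z → 64 * z + 8192 * z + 2 * z ≡ 8258 * z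
    middle = solve-∀
    right : ∀ x y z → 16384 * (z * x * y) ≡ z * y * (x * 16384)
    right = solve-∀

  -- A mass of at most 2 ^ (2 ^ (b + 3)) cost levels, each worth 2 ^ (b + 7) times ε, has room for
  -- fewer than 2 ^ g disjoint ε-balls when g = 2 ^ (b + 4).
  exponent-fits : ∀ b → 2 ^ (b + 3) + (b + 7) < 2 ^ (b + 4)
  exponent-fits b = begin-strict
    2 ^ (b + 3) + (b + 7)        <⟨ +-monoʳ-< (2 ^ (b + 3)) (b+7<2^[b+3] b) ⟩
    2 ^ (b + 3) + 2 ^ (b + 3)    ≤⟨ +-monoʳ-≤ (2 ^ (b + 3)) (m≤m+n _ 0) ⟩
    2 ^ suc (b + 3)              ≡⟨ cong (2 ^_) (sym (+-suc b 3)) ⟩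
    2 ^ (b + 4)                  ∎

  opaque
    -- The summand 1 serves heavy balls. The other serves light ones, where a cost level is 2 ^ (b +
    -- 8) times ε/2; the truncation at `D` keeps its sum over `b` linear in `D`.
    chargeRate : ℕ → ℕ → ℕ
    chargeRate D b = 1 + 2 ^ 8 * truncated D b

    κ : ℕ
    κ = 2 ^ 9

    1≤κ : 1 ≤ κ
    1≤κ = 1≤2^ 9

    1≤chargeRate : ∀ D b → 1 ≤ chargeRate D b
    1≤chargeRate D b = s≤s z≤n

    chargeRate-≥ : ∀ {D b} → 2 ^ b ≤ D → 2 ^ (b + 8) ≤ chargeRate D b
    chargeRate-≥ {D} {b} p = begin
      2 ^ (b + 8)           ≡⟨ trans (2^-+ b 8) (*-comm (2 ^ b) (2 ^ 8)) ⟩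
      2 ^ 8 * 2 ^ b         ≡⟨ cong (2 ^ 8 *_) (truncated-≤ {D} {b} p) ⟨
      2 ^ 8 * truncated D b ≤⟨ n≤1+n _ ⟩
      chargeRate D b        ∎

    sumTo-chargeRate : ∀ D n → sumTo n (chargeRate D) ≤ n + κ * D
    sumTo-chargeRate D n = begin
      sumTo n (chargeRate D)
        ≡⟨ sumTo-+ n (λ _ → 1) (λ b → 2 ^ 8 * truncated D b) ⟩
      sumTo n (λ _ → 1) + sumTo n (λ b → 2 ^ 8 * truncated D b)
        ≡⟨ cong₂ _+_ (trans (sumTo-const n 1) (*-identityʳ n)) (sumTo-* n (2 ^ 8) (truncated D)) ⟩
      n + 2 ^ 8 * sumTo n (truncated D)
        ≤⟨ +-monoʳ-≤ n (*-monoʳ-≤ (2 ^ 8) (proj₂ (sumTo-truncated D n))) ⟩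
      n + 2 ^ 8 * (2 * D)
        ≡⟨ cong (n +_) (*-assoc (2 ^ 8) 2 D) ⟨
      n + κ * D ∎

  -- At one level `j` the rates sum over `b` to a constant plus a multiple of the growth between `j`
  -- and `j + w`. Over all levels the growth telescopes, each increment being seen at most `w`
  -- times. The leading 1 pays for the pairs below the lowest level.
  total-chargeRate : ∀ (f : ℕ → ℕ) m A B → (∀ i → f i ≤ f (suc i)) → (∀ i → f i ≤ suc m) →
    let w = suc ((B + 8) + (B + A + 6)) in
    1 + sumTo (suc m) (λ j → sumTo (suc B) (λ b → 4 * chargeRate (suc (f (j + w) ∸ f j)) b)) ≤
    κ * 16 * (suc m * (B + A + 9))
  total-chargeRate f m A B mono bound = begin
    1 + sumTo (suc m) (λ j → sumTo (suc B) (λ b → 4 * chargeRate (suc (Δ j)) b))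
      ≤⟨ s≤s (sumTo-mono-≤ (suc m) (λ j _ → level-sum j)) ⟩
    1 + sumTo (suc m) (λ j → 4 * (suc B + κ) + 4 * κ * Δ j)
      ≡⟨ cong suc (sumTo-+ (suc m) (λ _ → 4 * (suc B + κ)) (λ j → 4 * κ * Δ j)) ⟩
    1 + (sumTo (suc m) (λ _ → 4 * (suc B + κ)) + sumTo (suc m) (λ j → 4 * κ * Δ j))
      ≡⟨ cong suc (cong₂ _+_ (sumTo-const (suc m) (4 * (suc B + κ))) (sumTo-* (suc m) (4 * κ) Δ)) ⟩
    1 + (suc m * (4 * (suc B + κ)) + 4 * κ * sumTo (suc m) Δ)
      ≤⟨ s≤s (+-monoʳ-≤ (suc m * (4 * (suc B + κ))) (*-monoʳ-≤ (4 * κ) (sumTo-telescope mono bound w (suc m)))) ⟩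
    1 + (suc m * (4 * (suc B + κ)) + 4 * κ * (w * suc m))
      ≤⟨ +-mono-≤ (*-mono-≤ 1≤κ (s≤s (z≤n {m}))) (+-monoˡ-≤ (4 * κ * (w * suc m)) (*-monoʳ-≤ (suc m) (*-monoʳ-≤ 4
           (+-monoˡ-≤ κ (≤-trans (≤-reflexive (sym (*-identityˡ (suc B)))) (*-monoˡ-≤ (suc B) 1≤κ)))))) ⟩
    κ * suc m + (suc m * (4 * (κ * suc B + κ)) + 4 * κ * (w * suc m))
      ≡⟨ collect κ (suc m) A B ⟩
    κ * suc m * (12 * B + 4 * A + 69)
      ≤⟨ *-monoʳ-≤ (κ * suc m) (≤-trans (m≤m+n _ (4 * B + 12 * A + 75)) (≤-reflexive (fill A B))) ⟩
    κ * suc m * (16 * (B + A + 9))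
      ≡⟨ collect′ κ (suc m) A B ⟩
    κ * 16 * (suc m * (B + A + 9)) ∎
    where
    w = suc ((B + 8) + (B + A + 6))
    Δ : ℕ → ℕ
    Δ j = f (j + w) ∸ f j
    regroup : ∀ κ B D → 4 * (B + κ * suc D) ≡ 4 * (B + κ) + 4 * κ * D
    regroup = solve-∀
    collect : ∀ κ m A B → κ * m + (m * (4 * (κ * suc B + κ)) + 4 * κ * (suc ((B + 8) + (B + A + 6)) * m)) ≡
              κ * m * (12 * B + 4 * A + 69)
    collect = solve-∀
    fill : ∀ A B → 12 * B + 4 * A + 69 + (4 * B + 12 * A + 75) ≡ 16 * (B + A + 9)
    fill = solve-∀
    collect′ : ∀ κ m A B → κ * m * (16 * (B + A + 9)) ≡ κ * 16 * (m * (B + A + 9))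
    collect′ = solve-∀
    level-sum : ∀ j → sumTo (suc B) (λ b → 4 * chargeRate (suc (Δ j)) b) ≤ 4 * (suc B + κ) + 4 * κ * Δ j
    level-sum j = begin
      sumTo (suc B) (λ b → 4 * chargeRate (suc (Δ j)) b) ≡⟨ sumTo-* (suc B) 4 (chargeRate (suc (Δ j))) ⟩
      4 * sumTo (suc B) (chargeRate (suc (Δ j)))
        ≤⟨ *-monoʳ-≤ 4 (sumTo-chargeRate (suc (Δ j)) (suc B)) ⟩
      4 * (suc B + κ * suc (Δ j))                        ≡⟨ regroup κ (suc B) (Δ j) ⟩
      4 * (suc B + κ) + 4 * κ * Δ j                      ∎

open Naturals

length-filter-∁ : ∀ {A : Set} {P : A → Set} (P? : Decidable P) xs →
                  length (filter P? xs) ℕ.+ length (filter (λ x → ¬? (P? x)) xs) ≡ length xs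
length-filter-∁ P? []       = refl
length-filter-∁ P? (x ∷ xs) with P? x
... | yes _ = ≡.cong suc (length-filter-∁ P? xs)
... | no  _ = ≡.trans (ℕₚ.+-suc _ _) (≡.cong suc (length-filter-∁ P? xs))

not-cover : ∀ b b′ → b ≡ b′ ⊎ b′ ≡ not b
not-cover false false = inj₁ refl
not-cover false true  = inj₂ refl
not-cover true  false = inj₂ refl
not-cover true  true  = inj₁ refl

not-not : ∀ b → b ≡ not (not b)
not-not false = refl
not-not true  = refl

module _ {A : Set} where

  Linked : List (A × A) → A → A → Set
  Linked S = Star (λ u v → (u , v) ∈ S)

-- Ordered-field arithmetic, integer multiples and sums over lists.

module Analysis (ℝ : RealNumbers) where
  open RealNumbers ℝ

  ≤-poset : Poset 0ℓ 0ℓ 0ℓ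
  ≤-poset = record { isPartialOrder = Order.isPartialOrder }

  module ≤-Reasoning = PartialOrderReasoning ≤-poset
  open ≤-Reasoning hiding (stop)

  open SemiringMult Ring.semiring public using (×-homo-+; ×-congʳ; ×-congˡ; ×-assocˡ; ×-homo-1; ×-assoc-*; ×1-homo-*)
    renaming (_×_ to infixr 7 _·_)
  open CommutativeMonoidMult Ring.+-commutativeMonoid public using (×-distrib-+)

  ≰⇒> : ∀ {x y} → ¬ (x ≤ y) → y < x
  ≰⇒> = Strict.≰⇒> _≈_ _≤_ Ring.sym Order.reflexive Order.total

  ≮⇒≥ : ∀ {x y} → ¬ (x < y) → y ≤ x
  ≮⇒≥ = Strict.≮⇒≥ _≈_ _≤_ Ring.sym Order._≟_ Order.reflexive Order.total

  <⇒≱ : ∀ {x y} → x < y → ¬ (y ≤ x)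
  <⇒≱ = Strict.<⇒≱ _≈_ _≤_ Order.antisym

  <⇒≤ : ∀ {x y} → x < y → x ≤ y
  <⇒≤ = proj₁

  ≤-<-trans : ∀ {x y z} → x ≤ y → y < z → x < z
  ≤-<-trans {x} {y} {z} p q = begin-strict x ≤⟨ p ⟩ y <⟨ q ⟩ z ∎

  <-≤-trans : ∀ {x y z} → x < y → y ≤ z → x < z
  <-≤-trans {x} {y} {z} p q = begin-strict x <⟨ p ⟩ y ≤⟨ q ⟩ z ∎

  +-mono-≤ : ∀ {x y u v} → x ≤ y → u ≤ v → x + u ≤ y + v
  +-mono-≤ {x} {y} {u} {v} p q = begin
    x + u ≤⟨ +-monoʳ-≤ x q ⟩
    x + v ≈⟨ Ring.+-comm x v ⟩
    v + x ≤⟨ +-monoʳ-≤ v p ⟩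
    v + y ≈⟨ Ring.+-comm v y ⟩
    y + v ∎

  +-monoˡ-≤ : ∀ z {x y} → x ≤ y → x + z ≤ y + z
  +-monoˡ-≤ z p = +-mono-≤ p Order.refl

  x≤x+y : ∀ {x y} → 0# ≤ y → x ≤ x + y
  x≤x+y {x} {y} p = begin x ≈⟨ Ring.+-identityʳ x ⟨ x + 0# ≤⟨ +-monoʳ-≤ x p ⟩ x + y ∎

  x≤y+x : ∀ {x y} → 0# ≤ y → x ≤ y + x
  x≤y+x {x} {y} p = begin x ≈⟨ Ring.+-identityˡ x ⟨ 0# + x ≤⟨ +-monoˡ-≤ x p ⟩ y + x ∎

  +-nonNegative : ∀ {x y} → 0# ≤ x → 0# ≤ y → 0# ≤ x + y
  +-nonNegative p q = Order.trans p (x≤x+y q)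

  +-cancelˡ-≤ : ∀ z {x y} → z + x ≤ z + y → x ≤ y
  +-cancelˡ-≤ z {x} {y} p = begin
    x               ≈⟨ undo x ⟨
    - z + (z + x)   ≤⟨ +-monoʳ-≤ (- z) p ⟩
    - z + (z + y)   ≈⟨ undo y ⟩
    y               ∎
    where
    undo : ∀ w → - z + (z + w) ≈ w
    undo w = begin-equality
      - z + (z + w) ≈⟨ Ring.+-assoc (- z) z w ⟨
      - z + z + w   ≈⟨ Ring.+-congʳ (Ring.-‿inverseˡ z) ⟩
      0# + w        ≈⟨ Ring.+-identityˡ w ⟩
      w             ∎

  ≤+⇒-≤ : ∀ {x y z} → x ≤ y + z → x + - y ≤ z
  ≤+⇒-≤ {x} {y} {z} p = +-cancelˡ-≤ y (begin
    y + (x + - y) ≈⟨ Ring.+-congˡ (Ring.+-comm x (- y)) ⟩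
    y + (- y + x) ≈⟨ Ring.+-assoc y (- y) x ⟨
    y + - y + x   ≈⟨ Ring.+-congʳ (Ring.-‿inverseʳ y) ⟩
    0# + x        ≈⟨ Ring.+-identityˡ x ⟩
    x             ≤⟨ p ⟩
    y + z         ∎)

  -≤⇒≤+ : ∀ {x y z} → x + - y ≤ z → x ≤ y + z
  -≤⇒≤+ {x} {y} {z} p = begin
    x             ≈⟨ Ring.+-identityˡ x ⟨
    0# + x        ≈⟨ Ring.+-congʳ (Ring.-‿inverseʳ y) ⟨
    y + - y + x   ≈⟨ Ring.+-assoc y (- y) x ⟩
    y + (- y + x) ≈⟨ Ring.+-congˡ (Ring.+-comm (- y) x) ⟩
    y + (x + - y) ≤⟨ +-monoʳ-≤ y p ⟩
    y + z         ∎

  *-monoˡ-≤ : ∀ {z x y} → 0# ≤ z → x ≤ y → z * x ≤ z * y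
  *-monoˡ-≤ {z} {x} {y} 0≤z x≤y = begin
    z * x                        ≤⟨ x≤x+y (*-nonNegative 0≤z 0≤y-x) ⟩
    z * x + z * (y + - x)        ≈⟨ Ring.distribˡ z x (y + - x) ⟨
    z * (x + (y + - x))          ≈⟨ Ring.*-congˡ x+[y-x]≈y ⟩
    z * y                        ∎
    where
    x+[y-x]≈y : x + (y + - x) ≈ y
    x+[y-x]≈y = begin-equality
      x + (y + - x) ≈⟨ Ring.+-congˡ (Ring.+-comm y (- x)) ⟩
      x + (- x + y) ≈⟨ Ring.+-assoc x (- x) y ⟨
      x + - x + y   ≈⟨ Ring.+-congʳ (Ring.-‿inverseʳ x) ⟩
      0# + y        ≈⟨ Ring.+-identityˡ y ⟩
      y             ∎
    0≤y-x : 0# ≤ y + - x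
    0≤y-x = +-cancelˡ-≤ x (begin
      x + 0#         ≈⟨ Ring.+-identityʳ x ⟩
      x              ≤⟨ x≤y ⟩
      y              ≈⟨ x+[y-x]≈y ⟨
      x + (y + - x)  ∎)

  *-monoʳ-≤ : ∀ {z x y} → 0# ≤ z → x ≤ y → x * z ≤ y * z
  *-monoʳ-≤ {z} {x} {y} 0≤z x≤y = begin
    x * z ≈⟨ Ring.*-comm x z ⟩
    z * x ≤⟨ *-monoˡ-≤ 0≤z x≤y ⟩
    z * y ≈⟨ Ring.*-comm z y ⟩
    y * z ∎

  *-mono-≤ : ∀ {x y u v} → 0# ≤ x → 0# ≤ v → x ≤ y → u ≤ v → x * u ≤ y * v
  *-mono-≤ {x} {y} {u} {v} 0≤x 0≤v x≤y u≤v = begin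
    x * u ≤⟨ *-monoˡ-≤ 0≤x u≤v ⟩
    x * v ≤⟨ *-monoʳ-≤ 0≤v x≤y ⟩
    y * v ∎

  0≤1 : 0# ≤ 1#
  0≤1 with Order.total 0# 1#
  ... | inj₁ p = p
  ... | inj₂ 1≤0 = begin
    0#            ≤⟨ *-nonNegative 0≤-1 0≤-1 ⟩
    - 1# * - 1#   ≈⟨ Ring.+-identityˡ _ ⟨
    0# + - 1# * - 1#  ≈⟨ Ring.+-congʳ (Ring.-‿inverseʳ 1#) ⟨
    1# + - 1# + - 1# * - 1#  ≈⟨ Ring.+-assoc 1# (- 1#) _ ⟩
    1# + (- 1# + - 1# * - 1#)  ≈⟨ Ring.+-congˡ (Ring.+-congʳ (Ring.*-identityʳ (- 1#))) ⟨
    1# + (- 1# * 1# + - 1# * - 1#)  ≈⟨ Ring.+-congˡ (Ring.distribˡ (- 1#) 1# (- 1#)) ⟨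
    1# + - 1# * (1# + - 1#)    ≈⟨ Ring.+-congˡ (Ring.*-congˡ (Ring.-‿inverseʳ 1#)) ⟩
    1# + - 1# * 0#    ≈⟨ Ring.+-congˡ (Ring.zeroʳ (- 1#)) ⟩
    1# + 0#    ≈⟨ Ring.+-identityʳ 1# ⟩
    1#            ∎
    where
    0≤-1 : 0# ≤ - 1#
    0≤-1 = +-cancelˡ-≤ 1# (begin
      1# + 0#   ≈⟨ Ring.+-identityʳ 1# ⟩
      1#        ≤⟨ 1≤0 ⟩
      0#        ≈⟨ Ring.-‿inverseʳ 1# ⟨
      1# + - 1# ∎)

  0<1 : 0# < 1#
  0<1 = 0≤1 , 0≉1

  ·-nonNegative : ∀ n {x} → 0# ≤ x → 0# ≤ n · x
  ·-nonNegative zero    _ = Order.refl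
  ·-nonNegative (suc n) p = +-nonNegative p (·-nonNegative n p)

  ·-zeroʳ : ∀ n → n · 0# ≈ 0#
  ·-zeroʳ zero    = Ring.refl
  ·-zeroʳ (suc n) = Ring.trans (Ring.+-identityˡ _) (·-zeroʳ n)

  ·-monoʳ-≤ : ∀ n {x y} → x ≤ y → n · x ≤ n · y
  ·-monoʳ-≤ zero    _ = Order.refl
  ·-monoʳ-≤ (suc n) p = +-mono-≤ p (·-monoʳ-≤ n p)

  ·-monoˡ-≤ : ∀ {m n x} → 0# ≤ x → m ℕ.≤ n → m · x ≤ n · x
  ·-monoˡ-≤ {n = n} 0≤x ℕ.z≤n     = ·-nonNegative n 0≤x
  ·-monoˡ-≤ {x = x} 0≤x (ℕ.s≤s p) = +-monoʳ-≤ x (·-monoˡ-≤ 0≤x p)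

  ·-cancelʳ-≤ : ∀ {m n x} → 0# < x → m · x ≤ n · x → m ℕ.≤ n
  ·-cancelʳ-≤ {m} {n} {x} 0<x p with m ℕₚ.≤? n
  ... | yes m≤n = m≤n
  ... | no  m≰n = contradiction (+-cancelˡ-≤ (n · x) (begin
    n · x + x       ≈⟨ Ring.+-comm (n · x) x ⟩
    suc n · x       ≤⟨ ·-monoˡ-≤ (<⇒≤ 0<x) (ℕₚ.≰⇒> m≰n) ⟩
    m · x           ≤⟨ p ⟩
    n · x           ≈⟨ Ring.+-identityʳ (n · x) ⟨
    n · x + 0#      ∎)) (<⇒≱ 0<x)

  ·≈fromℕ* : ∀ n x → n · x ≈ fromℕ n * x
  ·≈fromℕ* n x = begin-equality
    n · x          ≈⟨ ×-congʳ n (Ring.*-identityˡ x) ⟨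
    n · (1# * x)   ≈⟨ ×-assoc-* n 1# x ⟨
    fromℕ n * x    ∎

  fromℕ-mono-≤ : ∀ {m n} → m ℕ.≤ n → fromℕ m ≤ fromℕ n
  fromℕ-mono-≤ = ·-monoˡ-≤ 0≤1

  0<fromℕ : ∀ n → 1 ℕ.≤ n → 0# < fromℕ n
  0<fromℕ n 1≤n = <-≤-trans 0<1 (begin
    1#       ≈⟨ ×-homo-1 1# ⟨
    fromℕ 1  ≤⟨ fromℕ-mono-≤ 1≤n ⟩
    fromℕ n  ∎)

  interchange : ∀ a b c d → (a + b) + (c + d) ≈ (a + c) + (b + d)
  interchange a b c d = begin-equality
    (a + b) + (c + d) ≈⟨ Ring.+-assoc a b (c + d) ⟩
    a + (b + (c + d)) ≈⟨ Ring.+-congˡ (Ring.+-assoc b c d) ⟨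
    a + (b + c + d)   ≈⟨ Ring.+-congˡ (Ring.+-congʳ (Ring.+-comm b c)) ⟩
    a + (c + b + d)   ≈⟨ Ring.+-congˡ (Ring.+-assoc c b d) ⟩
    a + (c + (b + d)) ≈⟨ Ring.+-assoc a c (b + d) ⟨
    (a + c) + (b + d) ∎

  module _ {A : Set} where

    ∑[_] : (A → Carrier) → List A → Carrier
    ∑[ f ] xs = ∑ (map f xs)

    ∑-nonNegative : ∀ {f : A → Carrier} → (∀ x → 0# ≤ f x) → ∀ xs → 0# ≤ ∑[ f ] xs
    ∑-nonNegative p []       = Order.refl
    ∑-nonNegative p (x ∷ xs) = +-nonNegative (p x) (∑-nonNegative p xs)

    ∑-cong : ∀ {f g : A → Carrier} → (∀ x → f x ≈ g x) → ∀ xs → ∑[ f ] xs ≈ ∑[ g ] xs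
    ∑-cong p []       = Ring.refl
    ∑-cong p (x ∷ xs) = Ring.+-cong (p x) (∑-cong p xs)

    ∑-mono-≤ : ∀ {f g : A → Carrier} {xs} → All (λ x → f x ≤ g x) xs → ∑[ f ] xs ≤ ∑[ g ] xs
    ∑-mono-≤ []       = Order.refl
    ∑-mono-≤ (p ∷ ps) = +-mono-≤ p (∑-mono-≤ ps)

    ∑-≤-const : ∀ {f : A → Carrier} {z xs} → All (λ x → f x ≤ z) xs → ∑[ f ] xs ≤ length xs · z
    ∑-≤-const []       = Order.refl
    ∑-≤-const (p ∷ ps) = +-mono-≤ p (∑-≤-const ps)

    const-≤-∑ : ∀ {f : A → Carrier} {z xs} → All (λ x → z ≤ f x) xs → length xs · z ≤ ∑[ f ] xs
    const-≤-∑ []       = Order.refl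
    const-≤-∑ (p ∷ ps) = +-mono-≤ p (const-≤-∑ ps)

    ∈⇒≤∑ : ∀ {f : A → Carrier} → (∀ x → 0# ≤ f x) → ∀ {x xs} → x ∈ xs → f x ≤ ∑[ f ] xs
    ∈⇒≤∑ 0≤f {xs = _ ∷ xs} (here refl) = x≤x+y (∑-nonNegative 0≤f xs)
    ∈⇒≤∑ 0≤f (there x∈xs)              = Order.trans (∈⇒≤∑ 0≤f x∈xs) (x≤y+x (0≤f _))

    ∑-distrib-+ : ∀ (f g : A → Carrier) xs → ∑[ (λ x → f x + g x) ] xs ≈ ∑[ f ] xs + ∑[ g ] xs
    ∑-distrib-+ f g []       = Ring.sym (Ring.+-identityˡ 0#)
    ∑-distrib-+ f g (x ∷ xs) =
      Ring.trans (Ring.+-congˡ (∑-distrib-+ f g xs)) (interchange (f x) (g x) _ _)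

    ∑-zero : ∀ (xs : List A) → ∑[ (λ _ → 0#) ] xs ≈ 0#
    ∑-zero []       = Ring.refl
    ∑-zero (x ∷ xs) = Ring.trans (Ring.+-identityˡ _) (∑-zero xs)

    ∑-homo-· : ∀ n (f : A → Carrier) xs → ∑[ (λ x → n · f x) ] xs ≈ n · ∑[ f ] xs
    ∑-homo-· zero    f xs = ∑-zero xs
    ∑-homo-· (suc n) f xs =
      Ring.trans (∑-distrib-+ f (λ x → n · f x) xs) (Ring.+-congˡ (∑-homo-· n f xs))

  ∑-comm : ∀ {A B : Set} (f : A → B → Carrier) xs ys →
           ∑[ (λ x → ∑[ f x ] ys) ] xs ≈ ∑[ (λ y → ∑[ (λ x → f x y) ] xs) ] ys
  ∑-comm f []       ys = Ring.sym (∑-zero ys)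
  ∑-comm f (x ∷ xs) ys = Ring.trans (Ring.+-congˡ (∑-comm f xs ys))
    (Ring.sym (∑-distrib-+ (f x) (λ y → ∑[ (λ x → f x y) ] xs) ys))

  infixr 8 [_]⊙_

  -- The Iverson bracket of a decided proposition, times a number.
  [_]⊙_ : {P : Set} → Dec P → Carrier → Carrier
  [ yes _ ]⊙ x = x
  [ no  _ ]⊙ x = 0#

  ⊙-≤ : ∀ {P : Set} (P? : Dec P) {x} → 0# ≤ x → [ P? ]⊙ x ≤ x
  ⊙-≤ (yes _) _ = Order.refl
  ⊙-≤ (no  _) p = p

  ⊙-nonNegative : ∀ {P : Set} (P? : Dec P) {x} → 0# ≤ x → 0# ≤ [ P? ]⊙ x
  ⊙-nonNegative (yes _) p = p
  ⊙-nonNegative (no  _) _ = Order.refl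

  ⊙-mono : ∀ {P Q : Set} (P? : Dec P) (Q? : Dec Q) {x y} → 0# ≤ y → (P → Q) → (P → x ≤ y) →
           [ P? ]⊙ x ≤ [ Q? ]⊙ y
  ⊙-mono (yes p) (yes _) _   _   x≤y = x≤y p
  ⊙-mono (yes p) (no ¬q) _   P⇒Q _   = contradiction (P⇒Q p) ¬q
  ⊙-mono (no  _) Q?      0≤y _   _   = ⊙-nonNegative Q? 0≤y

  ⊙-true : ∀ {P : Set} (P? : Dec P) {x} → P → [ P? ]⊙ x ≈ x
  ⊙-true (yes _) _ = Ring.refl
  ⊙-true (no ¬p) p = contradiction p ¬p

  module _ {A : Set} {P : A → Set} (P? : ∀ a → Dec (P a)) where

    ∑-⊙-none : ∀ {x as} → All (λ a → ¬ P a) as → ∑[ (λ a → [ P? a ]⊙ x) ] as ≈ 0#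
    ∑-⊙-none []                  = Ring.refl
    ∑-⊙-none {as = a ∷ as} (¬p ∷ ps) with P? a
    ... | yes p = contradiction p ¬p
    ... | no  _ = Ring.trans (Ring.+-identityˡ _) (∑-⊙-none ps)

    ∑-⊙-unique : ∀ {x as} → 0# ≤ x → AllPairs (λ a b → ¬ (P a × P b)) as →
                 ∑[ (λ a → [ P? a ]⊙ x) ] as ≤ x
    ∑-⊙-unique 0≤x []       = 0≤x
    ∑-⊙-unique {x} {a ∷ as} 0≤x (p ∷ ps) with P? a
    ... | no  _  = Order.trans (Order.reflexive (Ring.+-identityˡ _)) (∑-⊙-unique 0≤x ps)
    ... | yes Pa = begin
      x + _   ≈⟨ Ring.+-congˡ (∑-⊙-none (All.map (λ ¬pq q → ¬pq (Pa , q)) p)) ⟩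
      x + 0#  ≈⟨ Ring.+-identityʳ x ⟩
      x       ∎

  -- Chains of pairs and the girth bound.

  module Chains {n k : ℕ}
    (d : Fin n → Fin n → Carrier) (end : Bool → Fin k → Fin n) where

    -- A walk of d-length at most N · ε in which jumps between the two ends of a pair in Q are free.
    data Chain (ε : Carrier) (Q : Fin k → Set) : Fin n → Fin n → ℕ → Set where
      gap : ∀ {u v N} → d u v ≤ N · ε → Chain ε Q u v N
      via : ∀ {u v m l N} p b → d u (end b p) ≤ m · ε → Q p →
            Chain ε Q (end (not b) p) v l → m ℕ.+ l ℕ.≤ N → Chain ε Q u v N

    mapChain : ∀ {ε Q Q′ u v N} → (∀ {p} → Q p → Q′ p) → Chain ε Q u v N → Chain ε Q′ u v N
    mapChain f (gap x)            = gap x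
    mapChain f (via p b x q ch l) = via p b x (f q) (mapChain f ch) l

  module Pseudometric {n k : ℕ}
    (d : Fin n → Fin n → Carrier)
    (d-refl : ∀ v → d v v ≤ 0#)
    (d-sym : ∀ u v → d u v ≤ d v u)
    (d-triangle : ∀ u v w → d u w ≤ d u v + d v w)
    (end : Bool → Fin k → Fin n)
    where
    open Chains d end public

    module _ {ε : Carrier} (0≤ε : 0# ≤ ε) where

      private variable
        Q Q′ : Fin k → Set
        u v w : Fin n
        l m N N′ : ℕ

      d-nonNegative : ∀ u v → 0# ≤ d u v
      d-nonNegative u v with Order.total 0# (d u v)
      ... | inj₁ p = p
      ... | inj₂ d≤0 = begin
        0#
          ≤⟨ +-cancelˡ-≤ (d u u) (Order.trans (Order.reflexive (Ring.+-identityʳ _)) (d-triangle u u u)) ⟩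
        d u u         ≤⟨ d-triangle u v u ⟩
        d u v + d v u ≤⟨ +-monoʳ-≤ (d u v) (Order.trans (d-sym v u) d≤0) ⟩
        d u v + 0#    ≈⟨ Ring.+-identityʳ _ ⟩
        d u v         ∎

      triangle-· : d u v ≤ m · ε → d v w ≤ l · ε → d u w ≤ (m ℕ.+ l) · ε
      triangle-· {u} {v} {m} {w} {l} p q = begin
        d u w            ≤⟨ d-triangle u v w ⟩
        d u v + d v w    ≤⟨ +-mono-≤ p q ⟩
        m · ε + l · ε    ≈⟨ ×-homo-+ ε m l ⟨
        (m ℕ.+ l) · ε    ∎

      weaken : N ℕ.≤ N′ → Chain ε Q u v N → Chain ε Q u v N′
      weaken N≤N′ (gap x)            = gap (Order.trans x (·-monoˡ-≤ 0≤ε N≤N′))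
      weaken N≤N′ (via p b x q ch l) = via p b x q ch (ℕₚ.≤-trans l N≤N′)

      prepend : d u v ≤ m · ε → Chain ε Q v w N → Chain ε Q u w (m ℕ.+ N)
      prepend {m = m} x (gap y) = gap (triangle-· {m = m} x y)
      prepend {m = m} x (via {m = m′} {l} p b y q ch le) =
        via p b (triangle-· {m = m} x y) q ch
          (ℕₚ.≤-trans (ℕₚ.≤-reflexive (ℕₚ.+-assoc m m′ l)) (ℕₚ.+-monoʳ-≤ m le))

      append : Chain ε Q u v N → Chain ε Q v w N′ → Chain ε Q u w (N ℕ.+ N′)
      append {N = N} (gap x) ch = prepend {m = N} x ch
      append {N′ = N′} (via {m = m} {l} p b x q ch le) ch′ =
        via {m = m} p b x q (append ch ch′)
          (ℕₚ.≤-trans (ℕₚ.≤-reflexive (≡.sym (ℕₚ.+-assoc m l N′))) (ℕₚ.+-monoˡ-≤ N′ le))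

      jump : ∀ p b → Q p → Chain ε Q (end (not b) p) v N → Chain ε Q (end b p) v N
      jump p b q ch = via p b (d-refl _) q ch ℕₚ.≤-refl

      reverse : Chain ε Q u v N → Chain ε Q v u N
      reverse (gap x) = gap (Order.trans (d-sym _ _) x)
      reverse {Q =
        Q} {v = v} (via {u} {m = m} {l} p b x q ch le) = weaken (ℕₚ.≤-trans (ℕₚ.≤-reflexive (ℕₚ.+-comm l m)) le)
        (append (reverse ch) (jump p (not b) q (≡.subst (λ b′ → Chain ε Q (end b′ p) u m) (not-not b)
          (gap (Order.trans (d-sym _ _) x)))))

      -- The prefix before the first use and the suffix after the last use of the pairs outside Q′.
      split : (∀ {p} → Q p → Dec (Q′ p)) → (∀ {p q} → Q p → Q q → ¬ Q′ p → ¬ Q′ q → p ≡ q) →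
              Chain ε Q u v N →
              Chain ε Q′ u v N ⊎
              ∃ λ f → Q f × ¬ Q′ f × ∃₂ λ b b′ → ∃₂ λ m l → m ℕ.+ l ℕ.≤ N ×
                Chain ε Q′ u (end b f) m × Chain ε Q′ (end b′ f) v l
      split dec uniq (gap x) = inj₁ (gap x)
      split dec uniq (via {m = m} {l} p b x q ch le) with dec q | split dec uniq ch
      ... | yes q′  | inj₁ ch′ = inj₁ (via p b x q′ ch′ le)
      ... | yes q′  | inj₂ (f , Qf , ¬Q′f , b₁ , b₂ , m₁ , m₂ , le′ , ch₁ , ch₂) =
        inj₂ (f , Qf , ¬Q′f , b₁ , b₂ , m ℕ.+ m₁ , m₂ ,
          ℕₚ.≤-trans (ℕₚ.≤-reflexive (ℕₚ.+-assoc m m₁ m₂)) (ℕₚ.≤-trans (ℕₚ.+-monoʳ-≤ m le′) le) ,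
          via p b x q′ ch₁ ℕₚ.≤-refl , ch₂)
      ... | no ¬Q′p | inj₁ ch′ =
        inj₂ (p , q , ¬Q′p , b , not b , m , l , le , gap x , ch′)
      ... | no ¬Q′p | inj₂ (f , Qf , ¬Q′f , b₁ , b₂ , m₁ , m₂ , le′ , ch₁ , ch₂)
        with refl ← uniq q Qf ¬Q′p ¬Q′f =
        inj₂ (p , q , ¬Q′p , b , b₂ , m , m₂ ,
          ℕₚ.≤-trans (ℕₚ.+-monoʳ-≤ m (ℕₚ.≤-trans (ℕₚ.m≤n+m m₂ m₁) le′)) le , gap x , ch₂)

      module Girth
        (c : Fin k → Carrier)
        (greedy : ∀ p {N} → Chain ε (λ q → toℕ q ℕ.< toℕ p) (end false p) (end true p) N → c p ≤ N · ε)
        (Q : Fin k → Set) (L : ℕ) (expensive : ∀ {p} → Q p → L · ε < c p)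
        where

        private
          Before : ℕ → Fin k → Fin k → Set
          Before T e q = Q q × q ≢ e × toℕ q ℕ.< T

        greedy′ : ∀ p b {N} → Chain ε (λ q → toℕ q ℕ.< toℕ p) (end b p) (end (not b) p) N → c p ≤ N · ε
        greedy′ p false ch = greedy p ch
        greedy′ p true  ch = greedy p (reverse ch)

        noEarlierChain : ∀ p b {N} → N ℕ.≤ L → Q p →
                         ¬ Chain ε (λ q → toℕ q ℕ.< toℕ p) (end b p) (end (not b) p) N
        noEarlierChain p b N≤L Qp ch =
          <⇒≱ (expensive Qp) (Order.trans (greedy′ p b ch) (·-monoˡ-≤ 0≤ε N≤L))

        -- The latest pair f of the closed chain contradicts greediness if it occurs once.
        -- If it occurs more often, then its first and last occurrence either can be cut out together
        -- or close up, with e, to a chain of pairs earlier than f.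
        girth-< : ∀ T e b {N} → N ℕ.≤ L → Q e → toℕ e ℕ.< T →
                  ¬ Chain ε (Before T e) (end b e) (end (not b) e) N
        girth-< (suc T) e b N≤L Qe e<1+T ch with toℕ e ℕₚ.≟ T
        ... | yes refl = noEarlierChain e b N≤L Qe
          (mapChain (λ (_ , q≢e , q<) → ℕₚ.≤∧≢⇒< (ℕ.s≤s⁻¹ q<) (q≢e ∘ toℕ-injective)) ch)
        ... | no  e≢T with split {Q′ = Before T e} decide same ch
          where
          decide : ∀ {p} → Before (suc T) e p → Dec (Before T e p)
          decide {p} (Qp , p≢e , p<) with toℕ p ℕₚ.≟ T
          ... | yes p≡T = no λ (_ , _ , p<T) → ℕₚ.<⇒≢ p<T p≡T
          ... | no  p≢T = yes (Qp , p≢e , ℕₚ.≤∧≢⇒< (ℕ.s≤s⁻¹ p<) p≢T)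
          last : ∀ {p} → Before (suc T) e p → ¬ Before T e p → toℕ p ≡ T
          last {p} (Qp , p≢e , p<) ¬p with toℕ p ℕₚ.≟ T
          ... | yes p≡T = p≡T
          ... | no  p≢T = contradiction (Qp , p≢e , ℕₚ.≤∧≢⇒< (ℕ.s≤s⁻¹ p<) p≢T) ¬p
          same : ∀ {p q} → Before (suc T) e p → Before (suc T) e q → ¬ Before T e p → ¬ Before T e q → p ≡ q
          same Bp Bq ¬p ¬q = toℕ-injective (≡.trans (last Bp ¬p) (≡.sym (last Bq ¬q)))
        ...   | inj₁ ch′ = girth-< T e b N≤L Qe e<T ch′
          where e<T = ℕₚ.≤∧≢⇒< (ℕ.s≤s⁻¹ e<1+T) e≢T
        ...   | inj₂ (f , (Qf , f≢e , f<) , ¬f , b₁ , b₂ , m , l , m+l≤N , ch₁ , ch₂)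
          with not-cover b₁ b₂
        ...     | inj₁ refl = girth-< T e b (ℕₚ.≤-trans m+l≤N N≤L) Qe e<T (append ch₁ ch₂)
          where e<T = ℕₚ.≤∧≢⇒< (ℕ.s≤s⁻¹ e<1+T) e≢T
        ...     | inj₂ refl = noEarlierChain f b₁ (ℕₚ.≤-trans m+l≤N N≤L) Qf
          (append (reverse (mapChain earlier ch₁)) (jump e b e<f (reverse (mapChain earlier ch₂))))
          where
          T≤f : T ℕ.≤ toℕ f
          T≤f = ℕₚ.≮⇒≥ (λ f<T → ¬f (Qf , f≢e , f<T))
          e<f : toℕ e ℕ.< toℕ f
          e<f = ℕₚ.<-≤-trans (ℕₚ.≤∧≢⇒< (ℕ.s≤s⁻¹ e<1+T) e≢T) T≤f
          earlier : ∀ {q} → Before T e q → toℕ q ℕ.< toℕ f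
          earlier (_ , _ , q<T) = ℕₚ.<-≤-trans q<T T≤f

        girth : ∀ {e b N} → N ℕ.≤ L → Q e → ¬ Chain ε (λ q → Q q × q ≢ e) (end b e) (end (not b) e) N
        girth {e} {b} N≤L Qe ch =
          girth-< k e b N≤L Qe (toℕ<n e) (mapChain (λ {q} (Qq , q≢e) → Qq , q≢e , toℕ<n q) ch)

        -- Ball growing and the extraction of separated endpoints.

        module Peeling
          (D′ : Carrier) (near : ∀ {p} → Q p → d (end false p) (end true p) ≤ D′)
          (g : ℕ) (4g+2≤L : 4 ℕ.* g ℕ.+ 2 ℕ.≤ L)
          where

          Far : Fin n → Fin n → Set
          Far u v = ¬ (d u v ≤ 2 · ε)

          IsEnd : (Fin k → Set) → Fin n → Set
          IsEnd E x = ∃₂ λ p b → E p × x ≡ end b p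

          -- How far one layer of ball growing can move in `d`: a gap of at most 2ε to an end of a
          -- pair, then the crossing of that pair.
          stride : Carrier
          stride = 2 · ε + D′

          near′ : ∀ {p} b → Q p → d (end b p) (end (not b) p) ≤ D′
          near′ false Qp = near Qp
          near′ true  Qp = Order.trans (d-sym _ _) (near Qp)

          module _
            (local : ∀ p {X} → Q p → AllPairs Far X → All (IsEnd Q) X →
                     All (λ x → d (end false p) x ≤ g · stride) X → length X ℕ.< 2 ℕ.^ g)
            where

            Touch : List (Fin n) → Fin k → Set
            Touch X p = ∃ λ b → Any (λ x → d (end b p) x ≤ 2 · ε) X

            touch? : ∀ X → Decidable (Touch X)
            touch? X p with any? (λ x → d (end false p) x Order.≤? 2 · ε) X
                          | any? (λ x → d (end true p) x Order.≤? 2 · ε) X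
            ... | yes t | _     = yes (false , t)
            ... | _     | yes t = yes (true , t)
            ... | no ¬t | no ¬u = no λ where
              (false , t) → ¬t t
              (true  , t) → ¬u t

            0≤D′ : ∀ {p} → Q p → 0# ≤ D′
            0≤D′ {p} Qp = Order.trans (d-nonNegative _ _) (near Qp)

            module _ (E : List (Fin k)) (QE : All Q E) where

              -- X consists of the vertices of the ball of radius r around root in the
              -- graph of the pairs; F is its edge set, a tree by the girth bound.
              record Ball (root : Fin n) (r : ℕ) (X : List (Fin n)) (F : List (Fin k)) : Set where
                field
                  far   : AllPairs Far X
                  reach : All (λ x → Chain ε (_∈ F) root x (2 ℕ.* r)) X
                  close : All (λ x → d root x ≤ r · stride) X
                  ends  : All (IsEnd (_∈ E)) X
                  edges : All (_∈ E) F

              module Step (root : Fin n) (r : ℕ) (r<g : r ℕ.< g)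
                (X : List (Fin n)) (F : List (Fin k)) (ball : Ball root r X F) where
                open Ball

                -- Each pair touching `X` contributes its other end as a new vertex. Were that end
                -- within 2ε of a vertex already present, the two chains to `root` would close up to
                -- a chain between the ends of the pair that is too short for the girth bound.
                grow : 0# ≤ D′ → ∀ ps → Unique ps → All (_∈ E) ps → All (_∉ F) ps → All (Touch X) ps →
                       ∃ λ X′ → Ball root (suc r) X′ (ps ++ F) × length X′ ≡ length ps ℕ.+ length X
                grow 0≤D′ [] _ _ _ _ = X , record
                  { far   = far ball
                  ; reach = All.map (weaken (ℕₚ.*-monoʳ-≤ 2 (ℕₚ.n≤1+n r))) (reach ball)
                  ; close = All.map (λ p → Order.trans p (x≤y+x (+-nonNegative (·-nonNegative 2 0≤ε) 0≤D′))) (close ball)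
                  ; ends  = ends ball
                  ; edges = edges ball
                  } , refl
                grow 0≤D′ (p ∷ ps) (p∉ps ∷ u) (p∈E ∷ ps⊆E) (p∉F ∷ ∉F) ((b , touch) ∷ touches)
                  with X′ , ball′ , len ← grow 0≤D′ ps u ps⊆E ∉F touches | x , x∈X , px ← find touch =
                  end (not b) p ∷ X′ , record
                    { far   = All.map isFar (reach ball′) ∷ far ball′
                    ; reach = weaken (ℕₚ.≤-reflexive ([2r]+2 r)) (append (mapChain (there ∘ ∈-++⁺ʳ ps) reach-x)
                                (via {m = 2} {0} p b (Order.trans (d-sym x _) px) (here refl) (gap (d-refl _)) ℕₚ.≤-refl))
                            ∷ All.map (mapChain there) (reach ball′)
                    ; close = close-p ∷ close ball′
                    ; ends  = (p , not b , p∈E , refl) ∷ ends ball′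
                    ; edges = p∈E ∷ edges ball′
                    } , ≡.cong suc len
                  where
                  Qp = All.lookup QE p∈E
                  reach-x : Chain ε (_∈ F) root x (2 ℕ.* r)
                  reach-x = All.lookup (reach ball) x∈X
                  [2r]+2 : ∀ r → 2 ℕ.* r ℕ.+ 2 ≡ 2 ℕ.* suc r
                  [2r]+2 = solve-∀
                  -- The closed chain consists of the gap to `x`, the way back to `root`, the way
                  -- out to a vertex `z` possibly of the new layer, and the gap from `z` to the
                  -- other end of the pair.
                  closed : ∀ r → 2 ℕ.+ (2 ℕ.* r ℕ.+ (2 ℕ.* suc r ℕ.+ 2)) ≡ 4 ℕ.* suc r ℕ.+ 2
                  closed = solve-∀
                  closed-≤ : 2 ℕ.+ (2 ℕ.* r ℕ.+ (2 ℕ.* suc r ℕ.+ 2)) ℕ.≤ L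
                  closed-≤ = ℕₚ.≤-trans (ℕₚ.≤-reflexive (closed r))
                    (ℕₚ.≤-trans (ℕₚ.+-monoˡ-≤ 2 (ℕₚ.*-monoʳ-≤ 4 r<g)) 4g+2≤L)
                  other : ∀ {q} → q ∈ ps ++ F → Q q × q ≢ p
                  other q∈ =
                    All.lookup QE (All.lookup (edges ball′) q∈) , λ q≡p → p∉ (≡.subst (_∈ ps ++ F) q≡p q∈)
                    where
                    p∉ : p ∉ ps ++ F
                    p∉ p∈ with ∈-++⁻ ps p∈
                    ... | inj₁ p∈ps = All.lookup p∉ps p∈ps refl
                    ... | inj₂ p∈F  = p∉F p∈F
                  isFar : ∀ {z} → Chain ε (_∈ ps ++ F) root z (2 ℕ.* suc r) → Far (end (not b) p) z
                  isFar reach-z pz = girth {b = b} closed-≤ Qp (mapChain other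
                    (prepend {m = 2} px (append (mapChain (∈-++⁺ʳ ps) (reverse reach-x))
                      (append reach-z (gap (Order.trans (d-sym _ _) pz))))))
                  close-p : d root (end (not b) p) ≤ suc r · stride
                  close-p = begin
                    d root (end (not b) p)
                      ≤⟨ d-triangle root x _ ⟩
                    d root x + d x (end (not b) p)
                      ≤⟨ +-monoʳ-≤ (d root x) (d-triangle x (end b p) _) ⟩
                    d root x + (d x (end b p) + d (end b p) (end (not b) p))
                      ≤⟨ +-mono-≤ (All.lookup (close ball) x∈X) (+-mono-≤ (Order.trans (d-sym x _) px) (near′ b Qp)) ⟩
                    r · stride + stride
                      ≈⟨ Ring.+-comm _ _ ⟩
                    suc r · stride ∎

              -- The outcome of a ball that stopped growing: the pairs removed number at most two
              -- per vertex of `X`, and the pairs that remain stay away from `X`.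
              record Cluster : Set where
                field
                  X         : List (Fin n)
                  rest      : List (Fin k)
                  far       : AllPairs Far X
                  ends      : All (IsEnd (_∈ E)) X
                  rest⊆     : All (_∈ E) rest
                  unique    : Unique rest
                  untouched : All (λ p → ¬ Touch X p) rest
                  smaller   : length rest ℕ.< length E
                  counted   : length E ℕ.≤ 2 ℕ.* length X ℕ.+ length rest

              -- Every layer either at least doubles the number of vertices or stops the growth.
              cluster : 0# ≤ D′ → ∀ fuel r → fuel ℕ.+ r ≡ g → ∀ p X F R → Q p → Ball (end false p) r X F →
                        length F ℕ.≤ length X → 2 ℕ.^ r ℕ.≤ length X →
                        All (_∈ E) R → Unique R → All (_∉ F) R → length F ℕ.+ length R ≡ length E →
                        0 ℕ.< length F ℕ.+ length (filter (touch? X) R) → Cluster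
              cluster 0≤D′ zero r refl p X F R Qp ball F≤X 2^r≤X R⊆E uR R∉F size nonempty =
                contradiction 2^r≤X (ℕₚ.<⇒≱ (local p Qp (Ball.far ball)
                  (All.map (λ (p , b , p∈E , eq) → p , b , All.lookup QE p∈E , eq) (Ball.ends ball)) (Ball.close ball)))
              cluster 0≤D′ (suc fuel) r eq p X F R Qp ball F≤X 2^r≤X R⊆E uR R∉F size nonempty
                with length F ℕ.+ length (filter (touch? X) R) ℕₚ.≤? 2 ℕ.* length X
              ... | yes stop = record
                { X         = X
                ; rest      = out
                ; far       = Ball.far ball
                ; ends      = Ball.ends ball
                ; rest⊆     = Allₚ.filter⁺ (λ p → ¬? (touch? X p)) R⊆E
                ; unique    = Uniqueₚ.filter⁺ (λ p → ¬? (touch? X p)) uR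
                ; untouched = Allₚ.all-filter (λ p → ¬? (touch? X p)) R
                ; smaller   = ≡.subst (length out ℕ.<_) total (ℕₚ.m<n+m (length out) nonempty)
                ; counted   = ≡.subst (ℕ._≤ 2 ℕ.* length X ℕ.+ length out) total (ℕₚ.+-monoˡ-≤ (length out) stop)
                }
                where
                out = filter (λ p → ¬? (touch? X p)) R
                total : length F ℕ.+ length (filter (touch? X) R) ℕ.+ length out ≡ length E
                total = ≡.trans (ℕₚ.+-assoc (length F) _ _)
                  (≡.trans (≡.cong (length F ℕ.+_) (length-filter-∁ (touch? X) R)) size)
              ... | no ¬stop
                with X′ , ball′ , len ← Step.grow (end false p) r
                       (ℕₚ.m+n≤o⇒n≤o fuel (ℕₚ.≤-reflexive (≡.trans (ℕₚ.+-suc fuel r) eq))) X F ball 0≤D′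
                       (filter (touch? X) R) (Uniqueₚ.filter⁺ (touch? X) uR)
                       (Allₚ.filter⁺ (touch? X) R⊆E)
                       (Allₚ.filter⁺ (touch? X) R∉F) (Allₚ.all-filter (touch? X) R) =
                cluster 0≤D′ fuel (suc r) (≡.trans (ℕₚ.+-suc fuel r) eq) p X′ (new ++ F) out Qp ball′
                  F′≤X′ (ℕₚ.≤-trans doubled (ℕₚ.≤-trans (ℕₚ.≤-reflexive (≡.sym |F′|)) F′≤X′))
                  (Allₚ.filter⁺ (λ p → ¬? (touch? X p)) R⊆E)
                  (Uniqueₚ.filter⁺ (λ p → ¬? (touch? X p)) uR)
                  fresh total
                  (ℕₚ.≤-trans (ℕₚ.≤-trans (ℕₚ.≤-trans (ℕ.s≤s ℕ.z≤n) (ℕₚ.≰⇒> ¬stop)) (ℕₚ.≤-reflexive (≡.sym |F′|)))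
                    (ℕₚ.m≤m+n _ _))
                where
                new = filter (touch? X) R
                out = filter (λ p → ¬? (touch? X p)) R
                |F′| : length (new ++ F) ≡ length F ℕ.+ length new
                |F′| = ≡.trans (length-++ new) (ℕₚ.+-comm (length new) (length F))
                -- The stopping test counts pairs. As every new pair brings one new vertex, `X`
                -- stays at least as long as `F`, which turns a doubling of pairs into a doubling of
                -- vertices.
                F′≤X′ : length (new ++ F) ℕ.≤ length X′
                F′≤X′ = ≡.subst₂ ℕ._≤_ (≡.sym (length-++ new)) (≡.sym len) (ℕₚ.+-monoʳ-≤ (length new) F≤X)
                doubled : 2 ℕ.^ suc r ℕ.≤ length F ℕ.+ length new
                doubled = ℕₚ.≤-trans (ℕₚ.*-monoʳ-≤ 2 2^r≤X) (ℕₚ.<⇒≤ (ℕₚ.≰⇒> ¬stop))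
                fresh : All (_∉ new ++ F) out
                fresh = All.tabulate λ {q} q∈out q∈ → case q∈out (∈-++⁻ new q∈)
                  where
                  case : ∀ {q} → q ∈ out → q ∈ new ⊎ q ∈ F → ⊥
                  case q∈out (inj₁ q∈new) = All.lookup (Allₚ.all-filter (λ p → ¬? (touch? X p)) R) q∈out
                                              (All.lookup (Allₚ.all-filter (touch? X) R) q∈new)
                  case q∈out (inj₂ q∈F)   = All.lookup (Allₚ.filter⁺ (λ p → ¬? (touch? X p)) R∉F) q∈out q∈F
                total : length (new ++ F) ℕ.+ length out ≡ length E
                total = ≡.trans (≡.cong (ℕ._+ length out) |F′|) (≡.trans (ℕₚ.+-assoc (length F) _ _)
                  (≡.trans (≡.cong (length F ℕ.+_) (length-filter-∁ (touch? X) R)) size))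

            -- Clusters are split off until no pair is left. Endpoints from different clusters are
            -- far apart because a remaining pair touches no earlier cluster; `fuel` suffices
            -- because every cluster removes a pair.
            peel : ∀ fuel E → length E ℕ.≤ fuel → All Q E → Unique E →
                   ∃ λ Y → AllPairs Far Y × All (IsEnd (_∈ E)) Y × length E ℕ.≤ 2 ℕ.* length Y
            peel _       []          _    _  _ = [] , [] , [] , ℕ.z≤n
            peel (suc m) E@(p ∷ E′) E≤ QE@(Qp ∷ _) uE
              with C ← cluster E QE (0≤D′ Qp) g 0 (ℕₚ.+-identityʳ g) p (end false p ∷ []) [] E Qp
                     (record
                       { far   = [] ∷ []
                       ; reach = gap (d-refl _) ∷ []
                       ; close = d-refl _ ∷ []
                       ; ends  = (p , false , here refl , refl) ∷ []
                       ; edges = []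
                       })
                     ℕ.z≤n ℕₚ.≤-refl (All.tabulate id) uE (All.tabulate (λ _ ())) refl
                     -- The pair `p` touches its own end, so the first cluster is not empty.
                     (∈-length (∈-filter⁺ (touch? (end false p ∷ [])) (here refl)
                       (false , here (Order.trans (d-refl _) (·-nonNegative 2 0≤ε)))))
              with Y , far , ends , counted ← peel m (Cluster.rest C) (ℕ.s≤s⁻¹ (ℕₚ.<-≤-trans (Cluster.smaller C) E≤))
                     (All.map (All.lookup QE) (Cluster.rest⊆ C)) (Cluster.unique C) =
              Cluster.X C ++ Y ,
              AllPairsₚ.++⁺ (Cluster.far C) far (All.tabulate λ x∈X → All.map (separate x∈X) ends) ,
              Allₚ.++⁺ (Cluster.ends C) (All.map (λ (q , b , q∈ , eq) → q , b , All.lookup (Cluster.rest⊆ C) q∈ , eq) ends) ,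
              total
              where
              separate : ∀ {x y} → x ∈ Cluster.X C → IsEnd (_∈ Cluster.rest C) y → Far x y
              separate x∈X (q , b , q∈ , refl) xy =
                All.lookup (Cluster.untouched C) q∈ (b , lose x∈X (Order.trans (d-sym _ _) xy))
              total : length E ℕ.≤ 2 ℕ.* length (Cluster.X C ++ Y)
              total =
                ℕₚ.≤-trans (Cluster.counted C) (ℕₚ.≤-trans (ℕₚ.+-monoʳ-≤ (2 ℕ.* length (Cluster.X C)) counted)
                (ℕₚ.≤-reflexive (≡.sym (≡.trans (≡.cong (2 ℕ.*_) (length-++ (Cluster.X C)))
                  (ℕₚ.*-distribˡ-+ 2 (length (Cluster.X C)) (length Y))))))

  -- Splitting a sum by an integer key and charging it to vertices.

  module Buckets where

    module _ {A : Set} where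

      ∑-filter-∁ : ∀ {P : A → Set} (P? : Decidable P) (f : A → Carrier) xs →
                   ∑[ f ] xs ≈ ∑[ f ] (filter P? xs) + ∑[ f ] (filter (λ x → ¬? (P? x)) xs)
      ∑-filter-∁ P? f []       = Ring.sym (Ring.+-identityˡ 0#)
      ∑-filter-∁ P? f (x ∷ xs) with P? x
      ... | yes _ = begin-equality
        f x + ∑[ f ] xs       ≈⟨ Ring.+-congˡ (∑-filter-∁ P? f xs) ⟩
        f x + (a + b)         ≈⟨ Ring.+-assoc (f x) a b ⟨
        f x + a + b           ∎
        where
        a = ∑[ f ] (filter P? xs)
        b = ∑[ f ] (filter (λ x → ¬? (P? x)) xs)
      ... | no _ = begin-equality
        f x + ∑[ f ] xs       ≈⟨ Ring.+-congˡ (∑-filter-∁ P? f xs) ⟩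
        f x + (a + b)         ≈⟨ Ring.+-assoc (f x) a b ⟨
        f x + a + b           ≈⟨ Ring.+-congʳ (Ring.+-comm (f x) a) ⟩
        a + f x + b           ≈⟨ Ring.+-assoc a (f x) b ⟩
        a + (f x + b)         ∎
        where
        a = ∑[ f ] (filter P? xs)
        b = ∑[ f ] (filter (λ x → ¬? (P? x)) xs)

    module _ {V : Set} (μ : V → Carrier) (vs : List V) where

      -- `F v` is the rate at which the mass of `v` is charged.
      weighted : (V → ℕ) → Carrier
      weighted F = ∑[ (λ v → F v · μ v) ] vs

      weighted-+ : ∀ F F′ → weighted F + weighted F′ ≈ weighted (λ v → F v ℕ.+ F′ v)
      weighted-+ F F′ = begin-equality
        weighted F + weighted F′                  ≈⟨ ∑-distrib-+ _ _ vs ⟨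
        ∑[ (λ v → F v · μ v + F′ v · μ v) ] vs    ≈⟨ ∑-cong (λ v → ×-homo-+ (μ v) (F v) (F′ v)) vs ⟨
        weighted (λ v → F v ℕ.+ F′ v)             ∎

      weighted-mono : (∀ v → 0# ≤ μ v) → ∀ {F F′} → (∀ v → F v ℕ.≤ F′ v) → weighted F ≤ weighted F′
      weighted-mono 0≤μ p = ∑-mono-≤ (All.universal (λ v → ·-monoˡ-≤ (0≤μ v) (p v)) vs)

      weighted-* : ∀ z F → weighted (λ v → z ℕ.* F v) ≈ z · weighted F
      weighted-* z F = begin-equality
        weighted (λ v → z ℕ.* F v)           ≈⟨ ∑-cong (λ v → ×-assocˡ (μ v) z (F v)) vs ⟨
        ∑[ (λ v → z · (F v · μ v)) ] vs      ≈⟨ ∑-homo-· z _ vs ⟩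
        z · weighted F                       ∎

      -- The bucket with the top key is split off; each bucket has its own rates, and these add up
      -- vertex by vertex. The property `P` is handed down to the buckets, so that bucketings can be
      -- nested.
      ∑-buckets : {A : Set} (key : A → ℕ) (f : A → Carrier) (P : A → Set) (F : ℕ → V → ℕ) → ∀ N →
        (∀ l → l ℕ.< N → ∀ xs → Unique xs → All (λ x → key x ≡ l × P x) xs → ∑[ f ] xs ≤ weighted (F l)) →
        ∀ xs → Unique xs → All (λ x → key x ℕ.< N × P x) xs →
        ∑[ f ] xs ≤ weighted (λ v → sumTo N (λ l → F l v))
      ∑-buckets key f P F zero    bound []       _ _ = ∑-nonNegative (λ _ → Order.refl) vs
      ∑-buckets key f P F zero    bound (_ ∷ _)  _ ((() , _) ∷ _)
      ∑-buckets key f P F (suc N) bound xs u below = begin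
        ∑[ f ] xs
          ≈⟨ ∑-filter-∁ top? f xs ⟩
        ∑[ f ] (filter top? xs) + ∑[ f ] (filter (λ x → ¬? (top? x)) xs)
          ≤⟨ +-mono-≤
               (bound N ℕₚ.≤-refl _ (Uniqueₚ.filter⁺ top? u)
                 (All.zipWith (λ (eq , _ , Px) → eq , Px) (Allₚ.all-filter top? xs , Allₚ.filter⁺ top? below)))
               (∑-buckets key f P F N (λ l l<N → bound l (ℕₚ.m≤n⇒m≤1+n l<N)) _ (Uniqueₚ.filter⁺ (λ x → ¬? (top? x)) u)
                 (All.zipWith (λ (neq , x<1+N , Px) → ℕₚ.≤∧≢⇒< (s≤s⁻¹ x<1+N) neq , Px)
                   (Allₚ.all-filter (λ x → ¬? (top? x)) xs , Allₚ.filter⁺ (λ x → ¬? (top? x)) below))) ⟩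
        weighted (F N) + weighted (λ v → sumTo N (λ l → F l v))
          ≈⟨ weighted-+ (F N) _ ⟩
        weighted (λ v → sumTo (suc N) (λ l → F l v)) ∎
        where
        top? : Decidable (λ x → key x ≡ N)
        top? x = key x ℕₚ.≟ N

  -- Rounded and truncated logarithms.

  module Levels
    (scale : ℕ → Carrier) (scale-mono : ∀ {i j} → i ℕ.≤ j → scale i ≤ scale j) where

    -- Since `scale` is monotone, this counts the thresholds among the first `N` that `x` has
    -- reached.
    level : ℕ → Carrier → ℕ
    level zero    x = 0
    level (suc N) x with scale N Order.≤? x
    ... | yes _ = suc N
    ... | no  _ = level N x

    level-≤ : ∀ N x → level N x ℕ.≤ N
    level-≤ zero    x = z≤n
    level-≤ (suc N) x with scale N Order.≤? x
    ... | yes _ = ℕₚ.≤-refl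
    ... | no  _ = ℕₚ.m≤n⇒m≤1+n (level-≤ N x)

    level-mono : ∀ N {x y} → x ≤ y → level N x ℕ.≤ level N y
    level-mono zero    p = z≤n
    level-mono (suc N) {x} {y} p with scale N Order.≤? x | scale N Order.≤? y
    ... | yes _ | yes _ = ℕₚ.≤-refl
    ... | yes q | no ¬q = contradiction (Order.trans q p) ¬q
    ... | no  _ | yes _ = ℕₚ.m≤n⇒m≤1+n (level-≤ N x)
    ... | no  _ | no  _ = level-mono N p

    <⇒level-≤ : ∀ N {x i} → x < scale i → level N x ℕ.≤ i
    <⇒level-≤ zero    p = z≤n
    <⇒level-≤ (suc N) {x} {i} p with scale N Order.≤? x
    ... | yes q = ℕₚ.≰⇒> λ i≤N → <⇒≱ p (Order.trans (scale-mono i≤N) q)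
    ... | no  _ = <⇒level-≤ N p

    <-level : ∀ N {x i} → i ℕ.< N → scale i ≤ x → i ℕ.< level N x
    <-level (suc N) {x} {i} i<1+N p with scale N Order.≤? x
    ... | yes _ = i<1+N
    ... | no ¬q = <-level N (ℕₚ.≤∧≢⇒< (s≤s⁻¹ i<1+N) λ { refl → ¬q p }) p

    level-≥ : ∀ N {x i} → level N x ≡ suc i → scale i ≤ x
    level-≥ (suc N) {x} eq with scale N Order.≤? x
    level-≥ (suc N) refl | yes p = p
    ... | no _ = level-≥ N eq

    level-< : ∀ N {x i} → i ℕ.< N → level N x ℕ.≤ i → x < scale i
    level-< N i<N p = ≰⇒> λ q → ℕₚ.<⇒≱ (<-level N i<N q) p

  -- Ball masses, packing and the charging of costs.

  module Charging {n k : ℕ}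
    (d : Fin n → Fin n → Carrier)
    (d-refl : ∀ v → d v v ≤ 0#)
    (d-sym : ∀ u v → d u v ≤ d v u)
    (d-triangle : ∀ u v w → d u w ≤ d u v + d v w)
    (end : Bool → Fin k → Fin n)
    (μ : Fin n → Carrier) (0≤μ : ∀ v → 0# ≤ μ v)
    where
    open Pseudometric d d-refl d-sym d-triangle end
    open Buckets

    V : List (Fin n)
    V = allFin n

    W : Carrier
    W = ∑[ μ ] V

    vol : Fin n → Carrier → Carrier
    vol v r = ∑[ (λ x → [ d v x <? r ]⊙ μ x) ] V

    vol-⊆ : ∀ {u v r s} → (∀ x → d u x < r → d v x < s) → vol u r ≤ vol v s
    vol-⊆ {u} {v} {r} {s} p =
      ∑-mono-≤ (All.universal (λ x → ⊙-mono (d u x <? r) (d v x <? s) (0≤μ x) (p x) (λ _ → Order.refl)) V)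

    vol-shift : ∀ {u v r s} → d v u + r ≤ s → vol u r ≤ vol v s
    vol-shift {u} {v} {r} {s} p = vol-⊆ λ x ux<r → ≤-<-trans (d-triangle v u x)
      (<-≤-trans (≰⇒> λ q → <⇒≱ ux<r (+-cancelˡ-≤ (d v u) q)) p)

    vol-mono : ∀ {v r s} → r ≤ s → vol v r ≤ vol v s
    vol-mono r≤s = vol-⊆ λ x vx<r → <-≤-trans vx<r r≤s

    vol-≤ : ∀ v r → vol v r ≤ W
    vol-≤ v r = ∑-mono-≤ (All.universal (λ x → ⊙-≤ (d v x <? r) (0≤μ x)) V)

    2·x≈x+x : ∀ x → 2 · x ≈ x + x
    2·x≈x+x x = Ring.+-congˡ (Ring.+-identityʳ x)

    -- By the separation of `Y`, a vertex lies in at most one of the open balls of radius ε, so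
    -- exchanging the sums counts every `h v` at most once.
    packing : ∀ {ε Y} {h : Fin n → Carrier} → (∀ v → 0# ≤ h v) → AllPairs (λ x y → ¬ (d x y ≤ 2 · ε)) Y →
              ∑[ (λ y → ∑[ (λ v → [ d y v <? ε ]⊙ h v) ] V) ] Y ≤ ∑[ h ] V
    packing {ε} {Y} {h} 0≤h far = begin
      ∑[ (λ y → ∑[ (λ v → [ d y v <? ε ]⊙ h v) ] V) ] Y ≈⟨ ∑-comm _ Y V ⟩
      ∑[ (λ v → ∑[ (λ y → [ d y v <? ε ]⊙ h v) ] Y) ] V ≤⟨ ∑-mono-≤ (All.universal single V) ⟩
      ∑[ h ] V ∎
      where
      single : ∀ v → ∑[ (λ y → [ d y v <? ε ]⊙ h v) ] Y ≤ h v
      single v = ∑-⊙-unique (λ y → d y v <? ε) (0≤h v) (AllPairs.map disjoint far)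
        where
        disjoint : ∀ {x y} → ¬ (d x y ≤ 2 · ε) → ¬ (d x v < ε × d y v < ε)
        disjoint {x} {y} xy (xv , yv) = xy (begin
          d x y          ≤⟨ d-triangle x v y ⟩
          d x v + d v y  ≤⟨ +-mono-≤ (<⇒≤ xv) (Order.trans (d-sym v y) (<⇒≤ yv)) ⟩
          ε + ε          ≈⟨ 2·x≈x+x ε ⟨
          2 · ε          ∎)

    -- The packing bound is applied to the mass cut off outside the ball around `root`; the small
    -- balls lose nothing by the cut.
    packing-number : ∀ {root R ε X} → AllPairs (λ x y → ¬ (d x y ≤ 2 · ε)) X →
                     All (λ x → d root x + ε ≤ R) X → All (λ x → ε ≤ vol x ε) X →
                     length X · ε ≤ vol root R
    packing-number {root} {R} {ε} {X} far inside heavy = begin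
      length X · ε
        ≤⟨ const-≤-∑ (All.zipWith bound (inside , heavy)) ⟩
      ∑[ (λ y → ∑[ (λ v → [ d y v <? ε ]⊙ [ d root v <? R ]⊙ μ v) ] V) ] X
        ≤⟨ packing (λ v → ⊙-nonNegative (d root v <? R) (0≤μ v)) far ⟩
      vol root R ∎
      where
      bound : ∀ {y} → (d root y + ε ≤ R) × (ε ≤ vol y ε) → ε ≤ ∑[ (λ v → [ d y v <? ε ]⊙ [ d root v <? R ]⊙ μ v) ] V
      bound {y} (p , q) = Order.trans q (∑-mono-≤ (All.universal (λ v →
        ⊙-mono (d y v <? ε) (d y v <? ε) (⊙-nonNegative (d root v <? R) (0≤μ v)) id
          (λ yv<ε → Order.reflexive (Ring.sym (⊙-true (d root v <? R)
            (≤-<-trans (d-triangle root y v) (<-≤-trans (≰⇒> λ r → <⇒≱ yv<ε (+-cancelˡ-≤ (d root y) r)) p)))))) V))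

    module _
      (c : Fin k → Carrier)
      (greedy : ∀ {ε} → 0# ≤ ε → ∀ p {N} →
                Chain ε (λ q → toℕ q ℕ.< toℕ p) (end false p) (end true p) N → c p ≤ N · ε)
      (grows : ∀ p b ρ → ρ ≤ c p → ρ ≤ vol (end b p) ρ)
      -- `m`, `A` and `B` stand for log k, log α and log log k, rounded up. The hypothesis `fits`
      -- puts every growth, which is at most `suc m`, into a class `b ≤ B`, and `W≈` makes the top
      -- cost level `scale m` equal to the total mass.
      (m A B : ℕ) (fits : suc m ℕ.≤ 2 ℕ.^ (B ℕ.+ 3))
      (r : ℕ → Carrier) (0<r : ∀ i → 0# < r i) (r-+ : ∀ i j → r (i ℕ.+ j) ≈ 2 ℕ.^ i · r j)
      (W≈ : W ≈ r (m ℕ.+ (B ℕ.+ 8)))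
      where

      0≤r : ∀ i → 0# ≤ r i
      0≤r i = <⇒≤ (0<r i)

      r-mono : ∀ {i j} → i ℕ.≤ j → r i ≤ r j
      r-mono {i} {j} i≤j = begin
        r i                      ≈⟨ ×-homo-1 (r i) ⟨
        1 · r i                  ≤⟨ ·-monoˡ-≤ (0≤r i) (1≤2^ (j ℕ.∸ i)) ⟩
        2 ℕ.^ (j ℕ.∸ i) · r i    ≈⟨ r-+ (j ℕ.∸ i) i ⟨
        r (j ℕ.∸ i ℕ.+ i)        ≡⟨ ≡.cong r (ℕₚ.m∸n+n≡m i≤j) ⟩
        r j                      ∎

      -- Radii are powers of two times the unit r 0.  At the cost level scale j, the header's R is
      -- r (reach j), and r j is at most every radius ε/2 occurring at that level.
      scale : ℕ → Carrier
      scale j = r (j ℕ.+ (B ℕ.+ 8))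

      scale-mono : ∀ {i j} → i ℕ.≤ j → scale i ≤ scale j
      scale-mono i≤j = r-mono (ℕₚ.+-monoˡ-≤ (B ℕ.+ 8) i≤j)

      open Levels scale scale-mono

      -- Above the last threshold `scale m` the level gives no upper bound, but there `W` does.
      level⇒≤scale : ∀ {x i} → x ≤ W → level (suc m) x ℕ.≤ i → x ≤ scale i
      level⇒≤scale {x} {i} x≤W p with i ℕₚ.≤? m
      ... | yes i≤m = <⇒≤ (level-< (suc m) (s≤s i≤m) p)
      ... | no  i≰m = begin
        x       ≤⟨ x≤W ⟩
        W       ≈⟨ W≈ ⟩
        scale m ≤⟨ scale-mono (ℕₚ.<⇒≤ (ℕₚ.≰⇒> i≰m)) ⟩
        scale i ∎

      f : Fin n → ℕ → ℕ
      f v i = level (suc m) (vol v (r i))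

      reach : ℕ → ℕ
      reach j = j ℕ.+ (B ℕ.+ 8) ℕ.+ (B ℕ.+ A ℕ.+ 6)

      -- Chosen so that `j + width` is `suc (reach j)`, the exponent of the radius 2R. It is the
      -- same for all `j`, as the telescoping sum requires.
      width : ℕ
      width = suc ((B ℕ.+ 8) ℕ.+ (B ℕ.+ A ℕ.+ 6))

      Δ : ℕ → Fin n → ℕ
      Δ j v = f v (j ℕ.+ width) ℕ.∸ f v j

      -- The rounded logarithm of the mass of the R-ball relative to the cost level. It classifies
      -- pairs, whereas `Δ` measures the same growth at a vertex that pays.
      growth : ℕ → Fin k → ℕ
      growth j p = f (end false p) (reach j) ℕ.∸ j

      χ : ℕ → ℕ → Fin n → ℕ
      χ j b v = chargeRate (suc (Δ j v)) b

      -- The header's g is 2 ^ (b + 3).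
      record InClass (j b : ℕ) (p : Fin k) : Set where
        field
          lower  : scale j ≤ c p
          upper  : c p ≤ scale (suc j)
          near   : d (end false p) (end true p) ≤ 2 ℕ.^ A · c p
          thin   : growth j p ℕ.≤ 2 ℕ.^ (b ℕ.+ 3)
          thick  : b ≡ 0 ⊎ 2 ℕ.^ b ℕ.≤ growth j p

      module ClassBound (j b : ℕ) (a : ℕ) (a+b≡B : a ℕ.+ b ≡ B) where
        open InClass

        -- With `a` equal to `B ∸ b`, the radius ε is `scale j` divided by 2 ^ (b + 7), that is, c /
        -- ε ~ g. The offset `B + 8` in `scale` keeps ε/2 at least `r j` for every `b ≤ B`.
        ε ε/2 D′ : Carrier
        ε   = r (suc (j ℕ.+ a))
        ε/2 = r (j ℕ.+ a)
        D′  = 2 ℕ.^ A · scale (suc j)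

        g L : ℕ
        g = 2 ℕ.^ (b ℕ.+ 4)
        L = 4 ℕ.* g ℕ.+ 2

        0≤ε : 0# ≤ ε
        0≤ε = 0≤r _

        ε≈ : ε ≈ ε/2 + ε/2
        ε≈ = Ring.trans (r-+ 1 (j ℕ.+ a)) (2·x≈x+x ε/2)

        b≤B : b ℕ.≤ B
        b≤B = ≡.subst (b ℕ.≤_) a+b≡B (ℕₚ.m≤n+m b a)

        -- All inequalities between radii are checked in multiples of ε/2.
        r≈ε/2 : ∀ e i → e ℕ.+ (j ℕ.+ a) ≡ i → r i ≈ 2 ℕ.^ e · ε/2
        r≈ε/2 e i refl = r-+ e (j ℕ.+ a)

        scale≈ε/2 : scale j ≈ 2 ℕ.^ (b ℕ.+ 8) · ε/2
        scale≈ε/2 = r≈ε/2 (b ℕ.+ 8) _ (≡.trans (go a b j) (≡.cong (λ B → j ℕ.+ (B ℕ.+ 8)) a+b≡B))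
          where
          go : ∀ a b j → b ℕ.+ 8 ℕ.+ (j ℕ.+ a) ≡ j ℕ.+ (a ℕ.+ b ℕ.+ 8)
          go = solve-∀

        D′≈ε/2 : D′ ≈ 2 ℕ.^ (A ℕ.+ (b ℕ.+ 9)) · ε/2
        D′≈ε/2 = Ring.trans (Ring.sym (r-+ A _)) (r≈ε/2 (A ℕ.+ (b ℕ.+ 9)) _
          (≡.trans (go A a b j) (≡.cong (λ B → A ℕ.+ (suc j ℕ.+ (B ℕ.+ 8))) a+b≡B)))
          where
          go : ∀ A a b j → A ℕ.+ (b ℕ.+ 9) ℕ.+ (j ℕ.+ a) ≡ A ℕ.+ (suc j ℕ.+ (a ℕ.+ b ℕ.+ 8))
          go = solve-∀

        R≈ε/2 : r (reach j) ≈ 2 ℕ.^ (B ℕ.+ A ℕ.+ (b ℕ.+ 14)) · ε/2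
        R≈ε/2 = r≈ε/2 (B ℕ.+ A ℕ.+ (b ℕ.+ 14)) _
          (≡.trans (go A a b j B) (≡.cong (λ B′ → j ℕ.+ (B′ ℕ.+ 8) ℕ.+ (B ℕ.+ A ℕ.+ 6)) a+b≡B))
          where
          go : ∀ A a b j B → B ℕ.+ A ℕ.+ (b ℕ.+ 14) ℕ.+ (j ℕ.+ a) ≡ j ℕ.+ (a ℕ.+ b ℕ.+ 8) ℕ.+ (B ℕ.+ A ℕ.+ 6)
          go = solve-∀

        ε≈2ε/2 : ε ≈ 2 · ε/2
        ε≈2ε/2 = r-+ 1 (j ℕ.+ a)

        L·ε<scale : L · ε < scale j
        L·ε<scale = ≰⇒> λ p → ℕₚ.<⇒≱ (cycle-shorter b) (·-cancelʳ-≤ (0<r (j ℕ.+ a)) (begin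
          2 ℕ.^ (b ℕ.+ 8) · ε/2   ≈⟨ scale≈ε/2 ⟨
          scale j                 ≤⟨ p ⟩
          L · ε                   ≈⟨ ×-congʳ L ε≈2ε/2 ⟩
          L · (2 · ε/2)           ≈⟨ ×-assocˡ ε/2 L 2 ⟩
          (L ℕ.* 2) · ε/2         ∎))
        near-D′ : ∀ {p} → InClass j b p → d (end false p) (end true p) ≤ D′
        near-D′ p = Order.trans (near p) (·-monoʳ-≤ (2 ℕ.^ A) (upper p))

        ε≤c : ∀ {p} → InClass j b p → ε ≤ c p
        ε≤c Cp = Order.trans (r-mono (≡.subst (λ B → suc (j ℕ.+ a) ℕ.≤ j ℕ.+ (B ℕ.+ 8)) a+b≡B
          (≡.subst (suc (j ℕ.+ a) ℕ.≤_) (go a b j) (ℕₚ.m≤m+n _ (b ℕ.+ 7))))) (lower Cp)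
          where
          go : ∀ a b j → suc (j ℕ.+ a) ℕ.+ (b ℕ.+ 7) ≡ j ℕ.+ (a ℕ.+ b ℕ.+ 8)
          go = solve-∀

        open Girth 0≤ε c (greedy 0≤ε) (InClass j b) L (λ Cp → <-≤-trans L·ε<scale (lower Cp))
        open Peeling D′ near-D′ g ℕₚ.≤-refl

        gstride+ε≤R : g · stride + ε ≤ r (reach j)
        gstride+ε≤R = begin
          g · (2 · ε + D′) + ε
            ≈⟨ Ring.+-cong (×-congʳ g (Ring.+-cong (Ring.trans (×-congʳ 2 ε≈2ε/2) (×-assocˡ ε/2 2 2)) D′≈ε/2)) ε≈2ε/2 ⟩
          g · (4 · ε/2 + 2 ℕ.^ (A ℕ.+ (b ℕ.+ 9)) · ε/2) + 2 · ε/2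
            ≈⟨ Ring.+-congʳ (×-congʳ g (×-homo-+ ε/2 4 (2 ℕ.^ (A ℕ.+ (b ℕ.+ 9))))) ⟨
          g · ((4 ℕ.+ 2 ℕ.^ (A ℕ.+ (b ℕ.+ 9))) · ε/2) + 2 · ε/2
            ≈⟨ Ring.+-congʳ (×-assocˡ ε/2 g (4 ℕ.+ 2 ℕ.^ (A ℕ.+ (b ℕ.+ 9)))) ⟩
          (g ℕ.* (4 ℕ.+ 2 ℕ.^ (A ℕ.+ (b ℕ.+ 9)))) · ε/2 + 2 · ε/2
            ≈⟨ ×-homo-+ ε/2 (g ℕ.* (4 ℕ.+ 2 ℕ.^ (A ℕ.+ (b ℕ.+ 9)))) 2 ⟨
          (g ℕ.* (4 ℕ.+ 2 ℕ.^ (A ℕ.+ (b ℕ.+ 9))) ℕ.+ 2) · ε/2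
            ≤⟨ ·-monoˡ-≤ (0≤r _) (strides-fit A b≤B) ⟩
          2 ℕ.^ (B ℕ.+ A ℕ.+ (b ℕ.+ 14)) · ε/2
            ≈⟨ R≈ε/2 ⟨
          r (reach j) ∎

        -- The ε-balls around `X` are disjoint, have mass at least ε each, and lie in the R-ball
        -- around an end of `p`, whose mass is bounded by `thin`.
        local : ∀ p {X} → InClass j b p → AllPairs Far X → All (IsEnd (InClass j b)) X →
                All (λ x → d (end false p) x ≤ g · stride) X → length X ℕ.< 2 ℕ.^ g
        local p {X} Cp far ends close = ℕₚ.≤-<-trans
          (·-cancelʳ-≤ (0<r (suc (j ℕ.+ a))) (begin
            length X · ε
              ≤⟨ packing-number far
                   (All.map (λ q → Order.trans (+-monoˡ-≤ ε q) gstride+ε≤R) close)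
                   (All.map (λ { (q , b , Cq , refl) → grows q b ε (ε≤c Cq) }) ends) ⟩
            vol (end false p) (r (reach j))
              ≤⟨ level⇒≤scale (vol-≤ _ _) (ℕₚ.≤-trans (ℕₚ.m≤n+m∸n _ j) (ℕₚ.+-monoʳ-≤ j (thin Cp))) ⟩
            scale (j ℕ.+ 2 ℕ.^ (b ℕ.+ 3))
              ≈⟨ scale≈ ⟩
            2 ℕ.^ (2 ℕ.^ (b ℕ.+ 3) ℕ.+ (b ℕ.+ 7)) · ε ∎))
          (ℕₚ.^-monoʳ-< 2 (s≤s (s≤s z≤n)) (exponent-fits b))
          where
          scale≈ : scale (j ℕ.+ 2 ℕ.^ (b ℕ.+ 3)) ≈ 2 ℕ.^ (2 ℕ.^ (b ℕ.+ 3) ℕ.+ (b ℕ.+ 7)) · ε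
          scale≈ =
            Ring.trans (Ring.reflexive (≡.cong r (≡.trans (≡.cong (λ B → j ℕ.+ e ℕ.+ (B ℕ.+ 8)) (≡.sym a+b≡B))
              (go a b j e))))
            (r-+ (e ℕ.+ (b ℕ.+ 7)) (suc (j ℕ.+ a)))
            where
            e = 2 ℕ.^ (b ℕ.+ 3)
            go : ∀ a b j e → j ℕ.+ e ℕ.+ (a ℕ.+ b ℕ.+ 8) ≡ e ℕ.+ (b ℕ.+ 7) ℕ.+ suc (j ℕ.+ a)
            go = solve-∀

        ε/2+D′≤R : ε/2 + D′ ≤ r (reach j)
        ε/2+D′≤R = begin
          ε/2 + D′                             ≈⟨ Ring.+-congˡ D′≈ε/2 ⟩
          suc q · ε/2                          ≤⟨ ·-monoˡ-≤ (0≤r _) suc-q≤ ⟩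
          2 ℕ.^ (B ℕ.+ A ℕ.+ (b ℕ.+ 14)) · ε/2 ≈⟨ R≈ε/2 ⟨
          r (reach j)                          ∎
          where
          q = 2 ℕ.^ (A ℕ.+ (b ℕ.+ 9))
          suc-q≤ : suc q ℕ.≤ 2 ℕ.^ (B ℕ.+ A ℕ.+ (b ℕ.+ 14))
          suc-q≤ =
            ℕₚ.≤-trans (ℕₚ.+-monoˡ-≤ q (ℕₚ.m≤m+n 1 3)) (ℕₚ.≤-trans (ℕₚ.m≤n*m (4 ℕ.+ q) g {{ℕₚ.m^n≢0 2 (b ℕ.+ 4)}})
            (ℕₚ.≤-trans (ℕₚ.m≤m+n _ 2) (strides-fit A b≤B)))

        -- If the ball of radius ε around y is heavy, it pays for scale j at rate 1. Otherwise the ball of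
        -- radius ε/2 pays at rate 2 ^ (b + 8), and f increases a lot at each of its points.
        charge : ∀ {y} → IsEnd (InClass j b) y → scale j ≤ ∑[ (λ v → [ d y v <? ε ]⊙ (χ j b v · μ v)) ] V
        charge (p , e , Cp , refl) with scale j Order.≤? vol (end e p) ε
        ... | yes heavy = Order.trans heavy (∑-mono-≤ (All.universal (λ v →
          ⊙-mono (d (end e p) v <? ε) (d (end e p) v <? ε) (·-nonNegative (χ j b v) (0≤μ v)) id
            (λ _ → Order.trans (Order.reflexive (Ring.sym (×-homo-1 (μ v)))) (·-monoˡ-≤ (0≤μ v) (1≤chargeRate _ b)))) V))
        ... | no light = begin
          scale j
            ≈⟨ scale≈ε/2 ⟩
          2 ℕ.^ (b ℕ.+ 8) · ε/2
            ≤⟨ ·-monoʳ-≤ (2 ℕ.^ (b ℕ.+ 8)) (grows p e ε/2 (Order.trans ε/2≤ε (ε≤c Cp))) ⟩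
          2 ℕ.^ (b ℕ.+ 8) · vol (end e p) ε/2
            ≈⟨ ∑-homo-· (2 ℕ.^ (b ℕ.+ 8)) _ V ⟨
          ∑[ (λ v → 2 ℕ.^ (b ℕ.+ 8) · [ d (end e p) v <? ε/2 ]⊙ μ v) ] V
            ≤⟨ ∑-mono-≤ (All.universal pointwise V) ⟩
          ∑[ (λ v → [ d (end e p) v <? ε ]⊙ (χ j b v · μ v)) ] V ∎
          where
          ε/2≤ε : ε/2 ≤ ε
          ε/2≤ε = r-mono (ℕₚ.n≤1+n _)
          -- The ball of radius ε/2 around `v` lies in the light ball of radius ε. Its mass bounds
          -- that of the ball of radius `r j`, a starting point common to all `b`, so that one `Δ j`
          -- serves every class.
          f-low : ∀ {v} → d (end e p) v < ε/2 → f v j ℕ.≤ j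
          f-low {v} yv = <⇒level-≤ (suc m) (≤-<-trans (begin
            vol v (r j)           ≤⟨ vol-mono (r-mono (ℕₚ.m≤m+n j a)) ⟩
            vol v ε/2
              ≤⟨ vol-shift (Order.trans (+-monoˡ-≤ ε/2 (<⇒≤ yv)) (Order.reflexive (Ring.sym ε≈))) ⟩
            vol (end e p) ε       ∎) (≰⇒> light))
          -- Growth is measured at `end false p`, even if the charge is for the other end. That
          -- vertex is within ε/2 + D′ ≤ R of `v`, so the ball of radius 2R around `v` contains its
          -- R-ball.
          f-high : ∀ {v} → d (end e p) v < ε/2 → f (end false p) (reach j) ℕ.≤ f v (j ℕ.+ width)
          f-high {v} yv = level-mono (suc m) (vol-shift (begin
            d v (end false p) + R               ≤⟨ +-monoˡ-≤ R (d-triangle v (end e p) (end false p)) ⟩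
            d v (end e p) + d (end e p) (end false p) + R
              ≤⟨ +-monoˡ-≤ R (+-mono-≤ (Order.trans (d-sym _ _) (<⇒≤ yv)) (to-false e)) ⟩
            ε/2 + D′ + R                        ≤⟨ +-monoˡ-≤ R ε/2+D′≤R ⟩
            R + R                               ≈⟨ 2·x≈x+x R ⟨
            2 · R                               ≈⟨ r-+ 1 (reach j) ⟨
            r (suc (reach j))
              ≡⟨ ≡.cong r (≡.trans (≡.cong suc (ℕₚ.+-assoc j _ _)) (≡.sym (ℕₚ.+-suc j _))) ⟩
            r (j ℕ.+ width)                     ∎))
            where
            R = r (reach j)
            to-false : ∀ e → d (end e p) (end false p) ≤ D′
            to-false false = Order.trans (d-refl _) (·-nonNegative (2 ℕ.^ A) (0≤r _))
            to-false true  = Order.trans (d-sym _ _) (near-D′ Cp)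
          rate : ∀ {v} → d (end e p) v < ε/2 → 2 ℕ.^ (b ℕ.+ 8) ℕ.≤ χ j b v
          rate {v} yv = chargeRate-≥ (enough (thick Cp))
            where
            enough : b ≡ 0 ⊎ 2 ℕ.^ b ℕ.≤ growth j p → 2 ℕ.^ b ℕ.≤ suc (Δ j v)
            -- The class `b ≡ 0` has no lower bound on the growth; the `suc` in `χ` provides the
            -- missing unit.
            enough (inj₁ refl) = s≤s z≤n
            enough (inj₂ q)    = ℕₚ.m≤n⇒m≤1+n (ℕₚ.≤-trans q (ℕₚ.∸-mono (f-high yv) (f-low yv)))
          pointwise : ∀ v → 2 ℕ.^ (b ℕ.+ 8) · [ d (end e p) v <? ε/2 ]⊙ μ v ≤ [ d (end e p) v <? ε ]⊙ (χ j b v · μ v)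
          pointwise v with d (end e p) v <? ε/2
          ... | no  _  = Order.trans (Order.reflexive (·-zeroʳ (2 ℕ.^ (b ℕ.+ 8))))
            (⊙-nonNegative (d (end e p) v <? ε) (·-nonNegative (χ j b v) (0≤μ v)))
          ... | yes yv = begin
            2 ℕ.^ (b ℕ.+ 8) · μ v                        ≤⟨ ·-monoˡ-≤ (0≤μ v) (rate yv) ⟩
            χ j b v · μ v                                ≈⟨ ⊙-true (d (end e p) v <? ε) (<-≤-trans yv ε/2≤ε) ⟨
            [ d (end e p) v <? ε ]⊙ (χ j b v · μ v)      ∎

        -- The factor 4 is 2 for the pairs per separated endpoint and 2 for the ratio of
        -- `scale (suc j)` to `scale j`.
        bound : ∀ E → Unique E → All (InClass j b) E → ∑[ c ] E ≤ weighted μ V (λ v → 4 ℕ.* χ j b v)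
        bound E uE CE =
          let Y , far , ends , counted = peel local (length E) E ℕₚ.≤-refl CE uE
          in count Y far ends counted
          where
          count : ∀ Y → AllPairs Far Y → All (IsEnd (_∈ E)) Y → length E ℕ.≤ 2 ℕ.* length Y →
                  ∑[ c ] E ≤ weighted μ V (λ v → 4 ℕ.* χ j b v)
          count Y far ends counted = begin
            ∑[ c ] E
              ≤⟨ ∑-≤-const (All.map upper CE) ⟩
            length E · scale (suc j)
              ≤⟨ ·-monoˡ-≤ (0≤r _) counted ⟩
            (2 ℕ.* length Y) · scale (suc j)
              ≈⟨ ×-congʳ (2 ℕ.* length Y) (r-+ 1 _) ⟩
            (2 ℕ.* length Y) · (2 · scale j)
              ≈⟨ ×-assocˡ _ (2 ℕ.* length Y) 2 ⟩
            (2 ℕ.* length Y ℕ.* 2) · scale j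
              ≈⟨ ×-congˡ (go (length Y)) ⟩
            (4 ℕ.* length Y) · scale j
              ≈⟨ ×-assocˡ _ 4 (length Y) ⟨
            4 · (length Y · scale j)
              ≤⟨ ·-monoʳ-≤ 4 (const-≤-∑
                 (All.map (λ { (q , e , q∈E , eq) → charge (q , e , All.lookup CE q∈E , eq) }) ends)) ⟩
            4 · ∑[ (λ y → ∑[ (λ v → [ d y v <? ε ]⊙ (χ j b v · μ v)) ] V) ] Y
              ≤⟨ ·-monoʳ-≤ 4 (packing (λ v → ·-nonNegative (χ j b v) (0≤μ v)) far) ⟩
            4 · weighted μ V (χ j b)
              ≈⟨ weighted-* μ V 4 (χ j b) ⟨
            weighted μ V (λ v → 4 ℕ.* χ j b v) ∎
            where
            go : ∀ y → 2 ℕ.* y ℕ.* 2 ≡ 4 ℕ.* y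
            go = solve-∀

      c≤W : ∀ p → c p ≤ W
      c≤W p = Order.trans (grows p false (c p) Order.refl) (vol-≤ _ _)

      growth-≤ : ∀ j p → growth j p ℕ.≤ 2 ℕ.^ (B ℕ.+ 3)
      growth-≤ j p = ℕₚ.≤-trans (ℕₚ.m∸n≤m _ j) (ℕₚ.≤-trans (level-≤ (suc m) _) fits)

      module _ (P : List (Fin k)) (uP : Unique P)
        (near : All (λ p → d (end false p) (end true p) ≤ 2 ℕ.^ A · c p) P)
        (few : length P ℕ.≤ 2 ℕ.^ m)
        where

        private
          Large : Fin k → Set
          Large p = 0 ℕ.< level (suc m) (c p) × d (end false p) (end true p) ≤ 2 ℕ.^ A · c p

          index : Fin k → ℕ
          index p = ℕ.pred (level (suc m) (c p))

          thickness : ℕ → Fin k → ℕ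
          thickness j p = least (growth j p) B

          classify : ∀ {j b p} → thickness j p ≡ b → index p ≡ j → Large p → InClass j b p
          classify {j} {b} {p} refl refl (0<level , near) = record
            { lower = level-≥ (suc m) level≡
            ; upper = level⇒≤scale (c≤W p) (ℕₚ.≤-reflexive level≡)
            ; near  = near
            ; thin  = least-qualifies (growth j p) B (growth-≤ j p)
            ; thick = thick (least (growth j p) B) refl
            }
            where
            level≡ : level (suc m) (c p) ≡ suc (index p)
            level≡ = ≡.sym (ℕₚ.suc-pred _ {{ℕ.>-nonZero 0<level}})
            thick : ∀ b → least (growth j p) B ≡ b → b ≡ 0 ⊎ 2 ℕ.^ b ℕ.≤ growth j p
            thick zero    _  = inj₁ refl
            -- Minimality says that exponent `b` failed, so the growth exceeds `2 ^ (b + 3)` and a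
            -- fortiori `2 ^ suc b`.
            thick (suc b) eq = inj₂ (ℕₚ.<⇒≤ (ℕₚ.≤-<-trans
              (2^-mono (ℕₚ.≤-trans (ℕₚ.≤-reflexive (ℕₚ.+-comm 1 b)) (ℕₚ.+-monoʳ-≤ b (s≤s z≤n))))
              (least-minimal (growth j p) B eq)))

          F : ℕ → Fin n → ℕ
          F j v = sumTo (suc B) (λ b → 4 ℕ.* χ j b v)

          class-bound : ∀ j b → b ℕ.< suc B → ∀ xs → Unique xs →
                        All (λ p → thickness j p ≡ b × index p ≡ j × Large p) xs →
                        ∑[ c ] xs ≤ weighted μ V (λ v → 4 ℕ.* χ j b v)
          class-bound j b b<1+B xs uxs q = ClassBound.bound j b (B ℕ.∸ b) (ℕₚ.m∸n+n≡m (s≤s⁻¹ b<1+B)) xs uxs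
            (All.map (λ (eq , eq′ , l) → classify eq eq′ l) q)

          level-bound : ∀ j → j ℕ.< suc m → ∀ xs → Unique xs → All (λ p → index p ≡ j × Large p) xs →
                        ∑[ c ] xs ≤ weighted μ V (F j)
          level-bound j _ xs uxs q =
            ∑-buckets μ V (thickness j) c (λ p → index p ≡ j × Large p) (λ b v → 4 ℕ.* χ j b v) (suc B)
            (class-bound j) xs uxs (All.map (λ l → s≤s (least-≤ _ B) , l) q)

          small? : Decidable (λ p → level (suc m) (c p) ≡ 0)
          small? p = level (suc m) (c p) ℕₚ.≟ 0

          small large : List (Fin k)
          small = filter small? P
          large = filter (λ p → ¬? (small? p)) P

          -- There are at most `2 ^ m` such pairs, and `2 ^ m` times `scale 0` is the total mass.
          small-bound : ∑[ c ] small ≤ W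
          small-bound = begin
            ∑[ c ] small
              ≤⟨ ∑-≤-const (All.map (λ {p} eq → level⇒≤scale (c≤W p) (ℕₚ.≤-reflexive eq)) (Allₚ.all-filter small? P)) ⟩
            length small · scale 0    ≤⟨ ·-monoˡ-≤ (0≤r _) (ℕₚ.≤-trans (length-filter small? P) few) ⟩
            2 ℕ.^ m · scale 0         ≈⟨ r-+ m (B ℕ.+ 8) ⟨
            scale m                   ≈⟨ W≈ ⟨
            W                         ∎

          large-bound : ∑[ c ] large ≤ weighted μ V (λ v → sumTo (suc m) (λ j → F j v))
          large-bound =
            ∑-buckets μ V index c Large F (suc m) level-bound large (Uniqueₚ.filter⁺ (λ p → ¬? (small? p)) uP)
            (All.zipWith (λ {p} (neq , near) →
                s≤s (ℕₚ.pred-mono-≤ (level-≤ (suc m) (c p))) , ℕₚ.n≢0⇒n>0 neq , near)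
              (Allₚ.all-filter (λ p → ¬? (small? p)) P , Allₚ.filter⁺ (λ p → ¬? (small? p)) near))

        total-bound : ∑[ c ] P ≤ (κ ℕ.* 16 ℕ.* (suc m ℕ.* (B ℕ.+ A ℕ.+ 9))) · W
        total-bound = begin
          ∑[ c ] P
            ≈⟨ ∑-filter-∁ small? c P ⟩
          ∑[ c ] small + ∑[ c ] large
            ≤⟨ +-mono-≤ small-bound large-bound ⟩
          W + weighted μ V (λ v → sumTo (suc m) (λ j → F j v))
            ≈⟨ Ring.+-congʳ (∑-cong (λ v → ×-homo-1 (μ v)) V) ⟨
          weighted μ V (λ _ → 1) + weighted μ V (λ v → sumTo (suc m) (λ j → F j v))
            ≈⟨ weighted-+ μ V (λ _ → 1) (λ v → sumTo (suc m) (λ j → F j v)) ⟩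
          weighted μ V (λ v → 1 ℕ.+ sumTo (suc m) (λ j → F j v))
            ≤⟨ weighted-mono μ V 0≤μ (λ v → total-chargeRate (f v) m A B
                 (λ i → level-mono (suc m) (vol-mono (r-mono (ℕₚ.n≤1+n i)))) (λ i → level-≤ (suc m) _)) ⟩
          weighted μ V (λ _ → K)
            ≈⟨ ∑-homo-· K μ V ⟩
          K · W ∎
          where
          K : ℕ
          K = κ ℕ.* 16 ℕ.* (suc m ℕ.* (B ℕ.+ A ℕ.+ 9))

  -- Walks, shortcuts and the state of the algorithm when a pair arrives.

  module Walks {n : ℕ} where
    open SteinerForest ℝ

    module _ {G : Graph n} where

      infixr 5 _⊕_

      _⊕_ : ∀ {u v w} → Walk G u v → Walk G v w → Walk G u w
      stop           ⊕ π′ = π′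
      step e e∈G j π ⊕ π′ = step e e∈G j (π ⊕ π′)

      length-⊕ : ∀ {u v w} (π : Walk G u v) (π′ : Walk G v w) →
                 walkLength (π ⊕ π′) ≈ walkLength π + walkLength π′
      length-⊕ stop           π′ = Ring.sym (Ring.+-identityˡ _)
      length-⊕ (step e _ _ π) π′ = Ring.trans (Ring.+-congˡ (length-⊕ π π′)) (Ring.sym (Ring.+-assoc _ _ _))

      Joins-sym : ∀ {e : Edge n} {u v} → Joins e u v → Joins e v u
      Joins-sym (inj₁ p) = inj₂ p
      Joins-sym (inj₂ p) = inj₁ p

      reverse : ∀ {u v} → Walk G u v → Walk G v u
      reverse stop             = stop
      reverse (step e e∈G j π) = reverse π ⊕ step e e∈G (Joins-sym {e} j) stop

      length-reverse : ∀ {u v} (π : Walk G u v) → walkLength (reverse π) ≈ walkLength π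
      length-reverse stop             = Ring.refl
      length-reverse (step e e∈G j π) = begin-equality
        walkLength (reverse π ⊕ step e e∈G (Joins-sym {e} j) stop)   ≈⟨ length-⊕ (reverse π) _ ⟩
        walkLength (reverse π) + (Edge.weight e + 0#)
          ≈⟨ Ring.+-cong (length-reverse π) (Ring.+-identityʳ _) ⟩
        walkLength π + Edge.weight e                                 ≈⟨ Ring.+-comm _ _ ⟩
        Edge.weight e + walkLength π                                 ∎

      from : ∀ {u v} z (π : Path G u v) → z ∈ vertices (proj₁ π) →
             ∃ λ (π′ : Path G z v) → pathLength π′ ≤ pathLength π
      from z (stop , u)           (here refl) = (stop , u) , Order.refl
      from z π@(step _ _ _ _ , _) (here refl) = π , Order.refl
      from z (step e _ _ π , _ ∷ u) (there z∈) with π′ , le ← from z (π , u) z∈ =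
        π′ , Order.trans le (x≤y+x (Edge.0≤weight e))

      -- Loops are cut out. Shortest paths are compared with simple paths only, while concatenation
      -- produces walks.
      toPath : ∀ {u v} (π : Walk G u v) → ∃ λ (π′ : Path G u v) → pathLength π′ ≤ walkLength π
      toPath stop = (stop , [] ∷ []) , Order.refl
      toPath (step {u} e e∈G j π) with toPath π
      ... | π′ , le with Data.List.Membership.DecPropositional._∈?_ _≟_ u (vertices (proj₁ π′))
      ...   | yes u∈ with π″ , le′ ← from u π′ u∈ =
        π″ , Order.trans le′ (Order.trans le (x≤y+x (Edge.0≤weight e)))
      ...   | no u∉ = (step e e∈G j (proj₁ π′) , Allₚ.¬Any⇒All¬ _ u∉ ∷ proj₂ π′) , +-monoʳ-≤ _ le

    embed : ∀ {G G′ : Graph n} → (∀ {e} → e ∈ G → e ∈ G′) → ∀ {u v} → Walk G u v → Walk G′ u v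
    embed f stop             = stop
    embed f (step e e∈G j π) = step e (f e∈G) j (embed f π)

    length-embed : ∀ {G G′ : Graph n} (f : ∀ {e} → e ∈ G → e ∈ G′) {u v} (π : Walk G u v) →
                   walkLength (embed f π) ≡ walkLength π
    length-embed f stop           = refl
    length-embed f (step e _ _ π) = ≡.cong (Edge.weight e +_) (length-embed f π)

    along : ∀ (G : Graph n) {S u v} → Linked S u v → ∃ λ (π : Walk (G ∪shortcuts S) u v) → walkLength π ≈ 0#
    along G ε⋆ = stop , Ring.refl
    along G (uv∈S ◅ l) with π , eq ← along G l =
      step (edge _ _ 0# Order.refl) (∈-++⁺ʳ G (∈-map⁺ _ uv∈S)) (inj₁ (refl , refl)) π ,
      Ring.trans (Ring.+-identityˡ _) eq

    module _ {G : Graph n} where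

      linked : ∀ {u v w} (π : Walk G v w) → Linked (consecutive (u ∷ vertices π)) u w
      linked stop           = here refl ◅ ε⋆
      linked (step _ _ _ π) = here refl ◅ Star.map there (linked π)

      -- `u` is the last vertex kept so far. The vertices between it and `v` may have been dropped,
      -- hence no adjacency of `u` and `v` is assumed.
      linked-filter : ∀ {P : Fin n → Set} (P? : Decidable P) {u v w} → P w → (π : Walk G v w) →
                      Linked (consecutive (u ∷ filter P? (vertices π))) u w
      linked-filter P? {w = w} Pw stop with P? w
      ... | yes _  = here refl ◅ ε⋆
      ... | no ¬Pw = contradiction Pw ¬Pw
      linked-filter P? {v = v} Pw (step _ _ _ π) with P? v
      ... | yes _ = here refl ◅ Star.map there (linked-filter P? Pw π)
      ... | no  _ = linked-filter P? Pw π

      linked-filter′ : ∀ {P : Fin n → Set} (P? : Decidable P) {v w} → P v → P w → (π : Walk G v w) →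
                       Linked (consecutive (filter P? (vertices π))) v w
      linked-filter′ P? Pv Pw stop = ε⋆
      linked-filter′ P? {v} Pv Pw (step _ _ _ π) with P? v
      ... | yes _  = linked-filter P? Pw π
      ... | no ¬Pv = contradiction Pv ¬Pv

      -- The property that the three rules share and on which the analysis rests: serving a pair
      -- joins its ends by shortcuts of weight 0.
      newShortcuts-linked : ∀ 𝒜 arrived {s t} (π : Walk G s t) → Linked (newShortcuts 𝒜 arrived s t (vertices π)) s t
      newShortcuts-linked greedy₁ _ stop           = ε⋆
      newShortcuts-linked greedy₁ _ (step _ _ _ π) = linked π
      newShortcuts-linked greedy₂ _ π              = here refl ◅ ε⋆
      newShortcuts-linked greedy₃ arrived π        =
        linked-filter′ _ (inj₁ (inj₁ refl)) (inj₁ (inj₂ refl)) π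

    -- A snapshot at the arrival of pair `i`, with `S` the shortcuts present then. The field
    -- `extends` carries the links of earlier pairs through the induction.
    record Served {𝒜 : Greedy} {G : Graph n} {k} (ps : Vec (Pair n) k) (S₀ : List (Pair n))
                  (cost : Carrier) (i : Fin k) : Set where
      field
        S        : List (Pair n)
        extends  : ∀ {p} → p ∈ S₀ → p ∈ S
        shortest : (π : uncurry (Walk (G ∪shortcuts S)) (Vec.lookup ps i)) → cost ≤ walkLength π
        free     : ∀ j → toℕ j ℕ.< toℕ i → uncurry (Linked S) (Vec.lookup ps j)

    served : ∀ {𝒜 G arrived S k} {ps : Vec (Pair n) k} (run : Execution 𝒜 G arrived S ps) i →
             Served {𝒜} {G} ps S (stepCost run i) i
    served {S = S} (serve π shortest run) zero = record
      { S        = S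
      ; extends  = id
      ; shortest = λ w → let π′ , le = toPath w in Order.trans (shortest π′) le
      ; free     = λ _ ()
      }
    served {𝒜} {arrived = arrived} {S} (serve π _ run) (suc i) = record
      { S        = Served.S rest
      ; extends  = Served.extends rest ∘ ∈-++⁺ˡ
      ; shortest = Served.shortest rest
      ; free     = λ where
          zero    _         → Star.map (Served.extends rest ∘ ∈-++⁺ʳ S) (newShortcuts-linked 𝒜 arrived (proj₁ π))
          (suc j) (s≤s j<i) → Served.free rest j j<i
      }
      where rest = served run i

  -- The capped distance in G as a pseudometric.

  module Distance {n : ℕ} (G : SteinerForest.Graph ℝ n)
    (cap : Carrier) (0≤cap : 0# ≤ cap) where
    open SteinerForest ℝ
    open Walks

    Reachable : Fin n → Fin n → Carrier → Set
    Reachable u v x = cap ≤ x ⊎ ∃ λ (π : Walk G u v) → walkLength π ≤ x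

    reachable-nonNegative : ∀ {u v x} → Reachable u v x → 0# ≤ x
    reachable-nonNegative (inj₁ p)       = Order.trans 0≤cap p
    reachable-nonNegative (inj₂ (π , p)) = Order.trans (0≤walkLength π) p

    private
      inf : ∀ u v → ∃ (IsInfimum (Reachable u v))
      inf u v = infimum (Reachable u v) (cap , inj₁ Order.refl) (0# , λ _ → reachable-nonNegative)

    opaque
      -- Capped so that it is finite for disconnected vertices as well.
      d : Fin n → Fin n → Carrier
      d u v = proj₁ (inf u v)

      d-lower : ∀ {u v x} → Reachable u v x → d u v ≤ x
      d-lower {u} {v} = proj₁ (proj₂ (inf u v)) _

      d-greatest : ∀ {u v y} → (∀ x → Reachable u v x → y ≤ x) → y ≤ d u v
      d-greatest {u} {v} = proj₂ (proj₂ (inf u v)) _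

    d-refl : ∀ v → d v v ≤ 0#
    d-refl v = d-lower (inj₂ (stop , Order.refl))

    d-sym : ∀ u v → d u v ≤ d v u
    d-sym u v = d-greatest λ where
      x (inj₁ p)       → d-lower (inj₁ p)
      x (inj₂ (π , p)) → d-lower (inj₂ (reverse π , Order.trans (Order.reflexive (length-reverse π)) p))

    -- Bounds in terms of `d` are derived from bounds for every `Reachable` length, so that no
    -- minimising walk has to be chosen.
    ≤+d : ∀ {u v y z} → (∀ x → Reachable u v x → y ≤ z + x) → y ≤ z + d u v
    ≤+d p = -≤⇒≤+ (d-greatest λ x r → ≤+⇒-≤ (p x r))

    d-triangle : ∀ u v w → d u w ≤ d u v + d v w
    d-triangle u v w = ≤+d λ y ry →
      Order.trans (≤+d λ x rx → concat rx ry) (Order.reflexive (Ring.+-comm y (d u v)))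
      where
      concat : ∀ {x y} → Reachable u v x → Reachable v w y → d u w ≤ y + x
      concat {x} {y} (inj₁ p) ry = d-lower (inj₁ (Order.trans p (x≤y+x (reachable-nonNegative ry))))
      concat {x} {y} rx (inj₁ p) = d-lower (inj₁ (Order.trans p (x≤x+y (reachable-nonNegative rx))))
      concat {x} {y} (inj₂ (π , p)) (inj₂ (π′ , q)) = d-lower (inj₂ (π ⊕ π′ , (begin
        walkLength (π ⊕ π′)            ≈⟨ length-⊕ π π′ ⟩
        walkLength π + walkLength π′   ≤⟨ +-mono-≤ p q ⟩
        x + y                          ≈⟨ Ring.+-comm x y ⟩
        y + x                          ∎)))

  -- The hypotheses of the charging argument, verified for a run.

  module Reduction {k : ℕ} {𝒜 : Greedy} (ℐ : SteinerForest.Instance ℝ k) (run : SteinerForest.Run ℝ 𝒜 ℐ)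
    (OPT : SteinerForest.Graph ℝ (SteinerForest.Instance.n ℐ)) (isOPT : SteinerForest.IsOPT ℝ ℐ OPT) where
    open SteinerForest ℝ
    open Walks
    open Instance ℐ

    c : Fin k → Carrier
    c = stepCost run

    0≤stepCost : ∀ {n 𝒜} {G : Graph n} {arrived S k} {ps : Vec (Pair n) k}
                 (run : Execution 𝒜 G arrived S ps) i → 0# ≤ stepCost run i
    0≤stepCost (serve π _ _)   zero    = 0≤walkLength (proj₁ π)
    0≤stepCost (serve _ _ run) (suc i) = 0≤stepCost run i

    0≤c : ∀ p → 0# ≤ c p
    0≤c = 0≤stepCost run

    -- Large enough that capping does not destroy `c p ≤ d`.
    cap : Carrier
    cap = ∑[ c ] (allFin k)

    c≤cap : ∀ p → c p ≤ cap
    c≤cap p = ∈⇒≤∑ 0≤c (∈-allFin p)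

    open Distance G cap (∑-nonNegative 0≤c (allFin k))

    end : Bool → Fin k → Fin n
    end false p = proj₁ (Vec.lookup pairs p)
    end true  p = proj₂ (Vec.lookup pairs p)

    open Chains d end

    module _ (p : Fin k) where
      open Served (served run p)

      private
        hop : ∀ b q → toℕ q ℕ.< toℕ p →
              ∃ λ (π : Walk (G ∪shortcuts S) (end b q) (end (not b) q)) → walkLength π ≈ 0#
        hop false q q<p = along G (free q q<p)
        hop true  q q<p with π , eq ← along G (free q q<p) =
          reverse π , Ring.trans (length-reverse π) eq

        include : ∀ {u v} → Walk G u v → Walk (G ∪shortcuts S) u v
        include = embed ∈-++⁺ˡ

      -- Induction on the chain, with `π` the walk built so far in the graph at the arrival of `p`:
      -- a gap appends a walk of G, and the crossing of an earlier pair appends its free shortcuts.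
      -- A gap that reaches the cap is harmless, because the cap bounds `c p`.
      cost-≤-chain : ∀ {ε u N} → 0# ≤ ε → (π : Walk (G ∪shortcuts S) (end false p) u) →
                     Chain ε (λ q → toℕ q ℕ.< toℕ p) u (end true p) N → c p ≤ walkLength π + N · ε
      cost-≤-chain {ε} {u} {N} 0≤ε π (gap le) = Order.trans (≤+d step-bound) (+-monoʳ-≤ (walkLength π) le)
        where
        step-bound : ∀ x → Reachable u (end true p) x → c p ≤ walkLength π + x
        step-bound x (inj₁ cap≤x)    = Order.trans (c≤cap p) (Order.trans cap≤x (x≤y+x (0≤walkLength π)))
        step-bound x (inj₂ (π′ , le)) = begin
          c p                                       ≤⟨ shortest (π ⊕ include π′) ⟩
          walkLength (π ⊕ include π′)               ≈⟨ length-⊕ π (include π′) ⟩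
          walkLength π + walkLength (include π′)    ≡⟨ ≡.cong (walkLength π +_) (length-embed ∈-++⁺ˡ π′) ⟩
          walkLength π + walkLength π′              ≤⟨ +-monoʳ-≤ (walkLength π) le ⟩
          walkLength π + x                          ∎
      cost-≤-chain {ε} {u} {N} 0≤ε π (via {m = m} {l} q b le q<p ch m+l≤N) = begin
        c p                                         ≤⟨ ≤+d step-bound ⟩
        walkLength π + l · ε + d u (end b q)        ≤⟨ +-monoʳ-≤ (walkLength π + l · ε) le ⟩
        walkLength π + l · ε + m · ε                ≈⟨ Ring.+-assoc _ _ _ ⟩
        walkLength π + (l · ε + m · ε)              ≈⟨ Ring.+-congˡ (Ring.+-comm _ _) ⟩
        walkLength π + (m · ε + l · ε)              ≈⟨ Ring.+-congˡ (×-homo-+ ε m l) ⟨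
        walkLength π + (m ℕ.+ l) · ε                ≤⟨ +-monoʳ-≤ (walkLength π) (·-monoˡ-≤ 0≤ε m+l≤N) ⟩
        walkLength π + N · ε                        ∎
        where
        step-bound : ∀ x → Reachable u (end b q) x → c p ≤ walkLength π + l · ε + x
        step-bound x (inj₁ cap≤x) = Order.trans (c≤cap p) (Order.trans cap≤x
          (x≤y+x (+-nonNegative (0≤walkLength π) (·-nonNegative l 0≤ε))))
        step-bound x (inj₂ (π′ , le)) with hop-π , hop≈0 ← hop b q q<p = begin
          c p
            ≤⟨ cost-≤-chain 0≤ε (π ⊕ include π′ ⊕ hop-π) ch ⟩
          walkLength (π ⊕ include π′ ⊕ hop-π) + l · ε
            ≈⟨ Ring.+-congʳ (Ring.trans (length-⊕ π _) (Ring.+-congˡ (Ring.trans (length-⊕ (include π′) hop-π)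
                 (Ring.trans (Ring.+-cong (Ring.reflexive (length-embed ∈-++⁺ˡ π′)) hop≈0) (Ring.+-identityʳ _))))) ⟩
          walkLength π + walkLength π′ + l · ε
            ≈⟨ Ring.+-assoc _ _ _ ⟩
          walkLength π + (walkLength π′ + l · ε)
            ≈⟨ Ring.+-congˡ (Ring.+-comm _ _) ⟩
          walkLength π + (l · ε + walkLength π′)
            ≈⟨ Ring.+-assoc _ _ _ ⟨
          walkLength π + l · ε + walkLength π′
            ≤⟨ +-monoʳ-≤ (walkLength π + l · ε) le ⟩
          walkLength π + l · ε + x ∎

    greedy : ∀ {ε} → 0# ≤ ε → ∀ p {N} → Chain ε (λ q → toℕ q ℕ.< toℕ p) (end false p) (end true p) N → c p ≤ N · ε
    greedy 0≤ε p ch = Order.trans (cost-≤-chain p 0≤ε stop ch) (Order.reflexive (Ring.+-identityˡ _))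

    c≤d : ∀ b p → c p ≤ d (end b p) (end (not b) p)
    c≤d true  p = Order.trans (c≤d false p) (d-sym _ _)
    c≤d false p = begin
      c p
        ≤⟨ greedy 0≤d p {1} (gap (Order.reflexive (Ring.sym (×-homo-1 _)))) ⟩
      1 · d (end false p) (end true p)         ≈⟨ ×-homo-1 _ ⟩
      d (end false p) (end true p)             ∎
      where
      0≤d : 0# ≤ d (end false p) (end true p)
      0≤d = d-greatest λ _ → reachable-nonNegative

    share : Fin n → Edge n → Carrier
    share v e = [ Edge.end₁ e ≟ v ]⊙ Edge.weight e + [ Edge.end₂ e ≟ v ]⊙ Edge.weight e

    μ : Fin n → Carrier
    μ v = ∑[ share v ] OPT

    0≤share : ∀ v e → 0# ≤ share v e
    0≤share v e = +-nonNegative (⊙-nonNegative (Edge.end₁ e ≟ v) (Edge.0≤weight e))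
                                (⊙-nonNegative (Edge.end₂ e ≟ v) (Edge.0≤weight e))

    0≤μ : ∀ v → 0# ≤ μ v
    0≤μ v = ∑-nonNegative (0≤share v) OPT

    weight≤μ : ∀ {e u v} → e ∈ OPT → Joins e u v → Edge.weight e ≤ μ u
    weight≤μ {e} {u} {v} e∈ joins = Order.trans (incident joins) (∈⇒≤∑ (0≤share u) e∈)
      where
      incident : Joins e u v → Edge.weight e ≤ share u e
      incident (inj₁ (eq , _)) = Order.trans (Order.reflexive (Ring.sym (⊙-true (Edge.end₁ e ≟ u) eq)))
        (x≤x+y (⊙-nonNegative (Edge.end₂ e ≟ u) (Edge.0≤weight e)))
      incident (inj₂ (_ , eq)) = Order.trans (Order.reflexive (Ring.sym (⊙-true (Edge.end₂ e ≟ u) eq)))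
        (x≤y+x (⊙-nonNegative (Edge.end₁ e ≟ u) (Edge.0≤weight e)))

    distinct : ∀ {xs : List (Fin n)} {u : Fin n} → Unique xs → AllPairs (λ x y → ¬ (u ≡ x × u ≡ y)) xs
    distinct = AllPairs.map λ x≢y (u≡x , u≡y) → x≢y (≡.trans (≡.sym u≡x) u≡y)

    ∑μ≤2OPT : ∑[ μ ] (allFin n) ≤ 2 · totalWeight OPT
    ∑μ≤2OPT = begin
      ∑[ μ ] (allFin n)
        ≈⟨ ∑-comm share (allFin n) OPT ⟩
      ∑[ (λ e → ∑[ (λ v → share v e) ] (allFin n)) ] OPT
        ≤⟨ ∑-mono-≤ (All.universal twice OPT) ⟩
      ∑[ (λ e → 2 · Edge.weight e) ] OPT
        ≈⟨ ∑-homo-· 2 Edge.weight OPT ⟩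
      2 · totalWeight OPT ∎
      where
      once : ∀ u {w} → 0# ≤ w → ∑[ (λ v → [ u ≟ v ]⊙ w) ] (allFin n) ≤ w
      once u 0≤w = ∑-⊙-unique (u ≟_) 0≤w (distinct (Uniqueₚ.allFin⁺ n))
      twice : ∀ (e : Edge n) → ∑[ (λ v → share v e) ] (allFin n)
                               ≤ 2 · Edge.weight e
      twice e = begin
        ∑[ (λ v → share v e) ] (allFin n)
          ≈⟨ ∑-distrib-+ (λ v → [ Edge.end₁ e ≟ v ]⊙ Edge.weight e)
                         (λ v → [ Edge.end₂ e ≟ v ]⊙ Edge.weight e) (allFin n) ⟩
        ∑[ (λ v → [ Edge.end₁ e ≟ v ]⊙ Edge.weight e) ] (allFin n) +
        ∑[ (λ v → [ Edge.end₂ e ≟ v ]⊙ Edge.weight e) ] (allFin n)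
          ≤⟨ +-mono-≤ (once (Edge.end₁ e) (Edge.0≤weight e)) (once (Edge.end₂ e) (Edge.0≤weight e)) ⟩
        Edge.weight e + Edge.weight e
          ≈⟨ Ring.+-congˡ (Ring.+-identityʳ _) ⟨
        2 · Edge.weight e ∎

    ∑-unique-≤ : ∀ {f : Fin n → Carrier} → (∀ v → 0# ≤ f v) → ∀ {xs} → Unique xs → ∑[ f ] xs ≤ ∑[ f ] (allFin n)
    ∑-unique-≤ {f} 0≤f {xs} uxs = begin
      ∑[ f ] xs
        ≤⟨ ∑-mono-≤ (All.universal (λ x → Order.trans (Order.reflexive (Ring.sym (⊙-true (x ≟ x) refl)))
             (∈⇒≤∑ {f = λ v → [ v ≟ x ]⊙ f v} (λ v → ⊙-nonNegative (v ≟ x) (0≤f v)) (∈-allFin x))) xs) ⟩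
      ∑[ (λ x → ∑[ (λ v → [ v ≟ x ]⊙ f v) ] (allFin n)) ] xs
        ≈⟨ ∑-comm (λ x v → [ v ≟ x ]⊙ f v) xs (allFin n) ⟩
      ∑[ (λ v → ∑[ (λ x → [ v ≟ x ]⊙ f v) ] xs) ] (allFin n)
        ≤⟨ ∑-mono-≤ (All.universal (λ v → ∑-⊙-unique (v ≟_) (0≤f v) (distinct uxs)) (allFin n)) ⟩
      ∑[ f ] (allFin n) ∎

    open Charging d d-refl d-sym d-triangle end μ 0≤μ using (vol; vol-≤; total-bound)

    OPT⊆G : ∀ {e} → e ∈ OPT → e ∈ G
    OPT⊆G = Sublist.lookup (proj₁ (proj₁ isOPT))

    inside : Fin n → Carrier → Fin n → Carrier
    inside x ρ v = [ d x v <? ρ ]⊙ μ v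

    0≤inside : ∀ x ρ v → 0# ≤ inside x ρ v
    0≤inside x ρ v = ⊙-nonNegative (d x v <? ρ) (0≤μ v)

    -- As long as the walk is inside the ball, the next step increases the distance from `x` by at
    -- most the weight of an edge of OPT at the current vertex, which its mass covers. The first
    -- vertex outside is already at distance ρ.
    escape : ∀ x ρ {v t} (π : Walk OPT v t) → ρ ≤ d x t → ρ ≤ d x v + ∑[ inside x ρ ] (vertices π)
    escape x ρ (stop {v}) ρ≤ = Order.trans ρ≤ (x≤x+y (∑-nonNegative (0≤inside x ρ) (v ∷ [])))
    escape x ρ (step {v} {w} e e∈ joins π) ρ≤ with d x v <? ρ
    ... | no  far  = Order.trans (≮⇒≥ far) (x≤x+y (+-nonNegative Order.refl (∑-nonNegative (0≤inside x ρ) (vertices π))))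
    ... | yes near = begin
      ρ                                                   ≤⟨ escape x ρ π ρ≤ ⟩
      d x w + ∑[ inside x ρ ] (vertices π)                ≤⟨ +-monoˡ-≤ _ (d-triangle x v w) ⟩
      d x v + d v w + ∑[ inside x ρ ] (vertices π)        ≈⟨ Ring.+-assoc _ _ _ ⟩
      d x v + (d v w + ∑[ inside x ρ ] (vertices π))      ≤⟨ +-monoʳ-≤ (d x v) (+-monoˡ-≤ _ dvw≤) ⟩
      d x v + (μ v + ∑[ inside x ρ ] (vertices π))        ∎
      where
      dvw≤ : d v w ≤ μ v
      dvw≤ =
        Order.trans (d-lower (inj₂ (step e (OPT⊆G e∈) joins stop , Order.reflexive (Ring.+-identityʳ _))))
          (weight≤μ e∈ joins)

    grows : ∀ p b ρ → ρ ≤ c p → ρ ≤ vol (end b p) ρ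
    grows p b ρ ρ≤c = begin
      ρ                                          ≤⟨ escape (end b p) ρ (proj₁ π) (Order.trans ρ≤c (c≤d b p)) ⟩
      d (end b p) (end b p) + ∑[ inside (end b p) ρ ] (vertices (proj₁ π))
        -- The vertices of a simple path are distinct, so the ball's mass is not counted twice.
        ≤⟨ +-mono-≤ (d-refl _) (∑-unique-≤ (λ v → ⊙-nonNegative (d (end b p) v <? ρ) (0≤μ v)) (proj₂ π)) ⟩
      0# + vol (end b p) ρ                       ≈⟨ Ring.+-identityˡ _ ⟩
      vol (end b p) ρ                            ∎
      where
      path : ∀ b → Path OPT (end b p) (end (not b) p)
      path false = proj₂ (proj₁ isOPT) p
      path true  = proj₁ (toPath (reverse (proj₁ (proj₂ (proj₁ isOPT) p))))
      π = path b

    -- An infinite contraction is not below α. Otherwise the capped distance is at most the distance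
    -- in G, and multiplying the contraction by the cost undoes the division.
    near : ∀ {α p} → (contraction ℐ run p <⁺ fin⁺ α) → d (end false p) (end true p) ≤ α * c p
    near {α} {p} below with c p Order.≟ 0#
    near {α} {p} () | yes _
    near {α} {p} (AddSupremumStrict.[ below ]) | no c≉0 = begin
      d (end false p) (end true p)
        ≤⟨ proj₂ (proj₂ infimum-distance) _ (λ x (π , eq) → d-lower (inj₂ (proj₁ π , Order.reflexive eq))) ⟩
      D                                ≈⟨ Ring.*-identityʳ D ⟨
      D * 1#
        ≈⟨ Ring.*-congˡ (Ring.trans (Ring.*-comm _ _) (proj₂ (invertible (c p) c≉0))) ⟨
      D * (c⁻¹ * c p)                  ≈⟨ Ring.*-assoc D c⁻¹ (c p) ⟨
      D * c⁻¹ * c p                    ≤⟨ *-monoʳ-≤ (0≤c p) (<⇒≤ below) ⟩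
      α * c p                          ∎
      where
      D = distance G (connected p)
      c⁻¹ = proj₁ (invertible (c p) c≉0)
      infimum-distance : ∃ (IsInfimum (IsPathLength G (end false p) (end true p)))
      infimum-distance = infimum _ _ _

    bound : ∀ m A B → k ℕ.≤ 2 ℕ.^ m → suc m ℕ.≤ 2 ℕ.^ (B ℕ.+ 3) → ∀ {α} → α ≤ fromℕ (2 ℕ.^ A) →
            cost ℐ run (pairsBelow ℐ run α) ≤ (κ ℕ.* 16 ℕ.* (suc m ℕ.* (B ℕ.+ A ℕ.+ 9))) · (2 · totalWeight OPT)
    bound m A B k≤2^m fits {α} α≤2^A = Order.trans main (·-monoʳ-≤ K ∑μ≤2OPT)
      where
      K = κ ℕ.* 16 ℕ.* (suc m ℕ.* (B ℕ.+ A ℕ.+ 9))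
      W = ∑[ μ ] (allFin n)
      P = pairsBelow ℐ run α
      below? : Decidable (λ i → contraction ℐ run i <⁺ fin⁺ α)
      below? i = <⁺-dec _<?_ (contraction ℐ run i) (fin⁺ α)
      close : All (λ p → d (end false p) (end true p) ≤ 2 ℕ.^ A · c p) P
      close = All.map (λ {p} q → begin
        d (end false p) (end true p)  ≤⟨ near q ⟩
        α * c p                       ≤⟨ *-monoʳ-≤ (0≤c p) α≤2^A ⟩
        fromℕ (2 ℕ.^ A) * c p         ≈⟨ ·≈fromℕ* (2 ℕ.^ A) (c p) ⟨
        2 ℕ.^ A · c p                 ∎) (Allₚ.all-filter below? (allFin k))
      few : length P ℕ.≤ 2 ℕ.^ m
      few =
        ℕₚ.≤-trans (length-filter below? (allFin k)) (ℕₚ.≤-trans (ℕₚ.≤-reflexive (length-tabulate id)) k≤2^m)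
      main : ∑[ c ] P ≤ K · W
      main with 0# <? W
      -- Without mass there is no positive unit of length, but then every cost is at most `W ≤ 0`.
      ... | no  W≤0 = begin
        ∑[ c ] P          ≤⟨ ∑-≤-const (All.universal (λ p → Order.trans (grows p false (c p) Order.refl)
                               (Order.trans (vol-≤ _ _) (≮⇒≥ W≤0))) P) ⟩
        length P · 0#     ≈⟨ ·-zeroʳ (length P) ⟩
        0#                ≤⟨ ·-nonNegative K (∑-nonNegative 0≤μ (allFin n)) ⟩
        K · W             ∎
      ... | yes 0<W = total-bound c greedy grows m A B fits r 0<r r-+ (Ring.sym r≈W) P
                        (Uniqueₚ.filter⁺ below? (Uniqueₚ.allFin⁺ k)) close few
        where
        N = m ℕ.+ (B ℕ.+ 8)
        2^N = fromℕ (2 ℕ.^ N)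
        inverse : ∃ λ y → 2^N * y ≈ 1#
        inverse = invertible 2^N λ 2^N≈0 → <⇒≱ (0<fromℕ _ (1≤2^ N)) (Order.reflexive 2^N≈0)
        -- The unit of length is `W` divided by `2 ^ N`, which makes `r N`, the top cost level,
        -- equal to `W`.
        u = W * proj₁ inverse
        r : ℕ → Carrier
        r i = 2 ℕ.^ i · u
        r-+ : ∀ i j → r (i ℕ.+ j) ≈ 2 ℕ.^ i · r j
        r-+ i j = Ring.trans (×-congˡ (2^-+ i j)) (Ring.sym (×-assocˡ u (2 ℕ.^ i) (2 ℕ.^ j)))
        r≈W : r N ≈ W
        r≈W = begin-equality
          2 ℕ.^ N · u                       ≈⟨ ·≈fromℕ* (2 ℕ.^ N) u ⟩
          2^N * (W * proj₁ inverse)         ≈⟨ Ring.*-congˡ (Ring.*-comm W (proj₁ inverse)) ⟩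
          2^N * (proj₁ inverse * W)         ≈⟨ Ring.*-assoc 2^N (proj₁ inverse) W ⟨
          2^N * proj₁ inverse * W           ≈⟨ Ring.*-congʳ (proj₂ inverse) ⟩
          1# * W                            ≈⟨ Ring.*-identityˡ W ⟩
          W                                 ∎
        0<u : 0# < u
        0<u = ≰⇒> λ u≤0 → <⇒≱ 0<W (begin
          W                ≈⟨ r≈W ⟨
          2 ℕ.^ N · u      ≤⟨ ·-monoʳ-≤ (2 ℕ.^ N) u≤0 ⟩
          2 ℕ.^ N · 0#     ≈⟨ ·-zeroʳ (2 ℕ.^ N) ⟩
          0#               ∎)
        0<r : ∀ i → 0# < r i
        0<r i =
          <-≤-trans 0<u (Order.trans (Order.reflexive (Ring.sym (×-homo-1 u))) (·-monoˡ-≤ (<⇒≤ 0<u) (1≤2^ i)))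

  -- Logarithms, their rounding, and the absorption of constants.

  module Logarithm (log : Carrier → Carrier) (isLog₂ : IsLog₂ ℝ log) where
    open IsLog₂ isLog₂

    log-cong : ∀ {x y} → 0# < x → x ≈ y → log x ≈ log y
    log-cong 0<x x≈y = Order.antisym (log-mono-≤ 0<x (Order.reflexive x≈y))
      (log-mono-≤ (<-≤-trans 0<x (Order.reflexive x≈y)) (Order.reflexive (Ring.sym x≈y)))

    0≤log1 : 0# ≤ log 1#
    0≤log1 = +-cancelˡ-≤ (log 1#) (begin
      log 1# + 0#        ≈⟨ Ring.+-identityʳ _ ⟩
      log 1#             ≈⟨ log-cong 0<1 (Ring.sym (Ring.*-identityˡ 1#)) ⟩
      log (1# * 1#)      ≈⟨ log-* 0<1 0<1 ⟩
      log 1# + log 1#    ∎)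

    0≤log : ∀ {x} → 1# ≤ x → 0# ≤ log x
    0≤log 1≤x = Order.trans 0≤log1 (log-mono-≤ 0<1 1≤x)

    log-2^ : ∀ n → fromℕ n ≤ log (fromℕ (2 ℕ.^ n))
    log-2^ zero    = 0≤log (Order.reflexive (Ring.sym (×-homo-1 1#)))
    log-2^ (suc n) = begin
      1# + fromℕ n                               ≤⟨ +-mono-≤ (Order.reflexive (Ring.sym log-2)) (log-2^ n) ⟩
      log (fromℕ 2) + log (fromℕ (2 ℕ.^ n))      ≈⟨ log-* 0<2 (0<fromℕ _ (1≤2^ n)) ⟨
      log (fromℕ 2 * fromℕ (2 ℕ.^ n))
        ≤⟨ log-mono-≤ (<-≤-trans (0<fromℕ _ (1≤2^ (suc n))) (Order.reflexive homo)) (Order.reflexive (Ring.sym homo)) ⟩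
      log (fromℕ (2 ℕ.^ suc n))                  ∎
      where
      0<2 : 0# < fromℕ 2
      0<2 = 0<fromℕ 2 (s≤s z≤n)
      homo : fromℕ (2 ℕ.^ suc n) ≈ fromℕ 2 * fromℕ (2 ℕ.^ n)
      homo = ×1-homo-* 2 (2 ℕ.^ n)

    -- Otherwise s − 1 would bound all powers of two below their supremum s.
    archimedean : ∀ x → ¬ (∀ n → fromℕ (2 ℕ.^ n) ≤ x)
    archimedean x bounded = <⇒≱ 0<1 (+-cancelˡ-≤ s (begin
      s + 1#             ≤⟨ +-monoˡ-≤ 1# (proj₂ (proj₂ supremum) (s + - 1#) below) ⟩
      s + - 1# + 1#      ≈⟨ Ring.+-assoc _ _ _ ⟩
      s + (- 1# + 1#)    ≈⟨ Ring.+-congˡ (Ring.-‿inverseˡ 1#) ⟩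
      s + 0#             ∎))
      where
      Power : Carrier → Set
      Power y = ∃ λ n → y ≈ fromℕ (2 ℕ.^ n)
      supremum : ∃ (IsSupremum Power)
      supremum =
        complete Power (fromℕ 1 , 0 , Ring.refl) (x , λ { y (n , eq) → Order.trans (Order.reflexive eq) (bounded n) })
      s = proj₁ supremum
      below : IsUpperBound Power (s + - 1#)
      below y (n , eq) = +-cancelˡ-≤ 1# (begin
        1# + y                  ≈⟨ Ring.+-congˡ eq ⟩
        fromℕ (suc (2 ℕ.^ n))   ≤⟨ fromℕ-mono-≤ (ℕₚ.+-mono-≤ (1≤2^ n) (ℕₚ.m≤m+n (2 ℕ.^ n) 0)) ⟩
        fromℕ (2 ℕ.^ suc n)     ≤⟨ proj₁ (proj₂ supremum) _ (suc n , Ring.refl) ⟩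
        s                       ≈⟨ Ring.+-identityˡ s ⟨
        0# + s                  ≈⟨ Ring.+-congʳ (Ring.-‿inverseʳ 1#) ⟨
        1# + - 1# + s           ≈⟨ Ring.+-assoc _ _ _ ⟩
        1# + (- 1# + s)         ≈⟨ Ring.+-congˡ (Ring.+-comm _ _) ⟩
        1# + (s + - 1#)         ∎)

    -- `n` is log x rounded up, with the lower bound on `n` in exponential form.
    CeilLog : Carrier → ℕ → Set
    CeilLog x n = x ≤ fromℕ (2 ℕ.^ n) × fromℕ n ≤ log x + 1#

    ceilLog-below : ∀ {x} → 1# ≤ x → ∀ n → x ≤ fromℕ (2 ℕ.^ n) → ∃ (CeilLog x)
    ceilLog-below {x} 1≤x zero    x≤ = 0 , x≤ , +-nonNegative (0≤log 1≤x) 0≤1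
    ceilLog-below {x} 1≤x (suc n) x≤ with x Order.≤? fromℕ (2 ℕ.^ n)
    ... | yes x≤′ = ceilLog-below 1≤x n x≤′
    ... | no  x≰  = suc n , x≤ , (begin
      1# + fromℕ n                     ≤⟨ +-monoʳ-≤ 1# (log-2^ n) ⟩
      1# + log (fromℕ (2 ℕ.^ n))       ≤⟨ +-monoʳ-≤ 1# (log-mono-≤ (0<fromℕ _ (1≤2^ n)) (<⇒≤ (≰⇒> x≰))) ⟩
      1# + log x                       ≈⟨ Ring.+-comm _ _ ⟩
      log x + 1#                       ∎)

    -- The exponent is found by an unbounded search, hence only up to double negation.
    ceilLog : ∀ {x} → 1# ≤ x → ¬ ¬ ∃ (CeilLog x)
    ceilLog {x} 1≤x none = archimedean x λ n → <⇒≤ (≰⇒> λ x≤ → none (ceilLog-below 1≤x n x≤))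

    module LogBounds (k : ℕ) (3≤k : 3 ℕ.≤ k) where
      ℓ λ′ : Carrier
      ℓ = log (fromℕ k)
      λ′ = log ℓ

      0<k : 0# < fromℕ k
      0<k = 0<fromℕ k (ℕₚ.≤-trans (s≤s z≤n) 3≤k)

      1≤ℓ : 1# ≤ ℓ
      1≤ℓ = begin
        1#              ≈⟨ log-2 ⟨
        log (fromℕ 2)   ≤⟨ log-mono-≤ (0<fromℕ 2 (s≤s z≤n)) (fromℕ-mono-≤ (ℕₚ.≤-trans (s≤s (s≤s z≤n)) 3≤k)) ⟩
        ℓ               ∎

      0≤ℓ : 0# ≤ ℓ
      0≤ℓ = Order.trans 0≤1 1≤ℓ

      0<ℓ : 0# < ℓ
      0<ℓ = <-≤-trans 0<1 1≤ℓ

      -- k ^ 2 ≥ 2 ^ 3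
      3≤2ℓ : fromℕ 3 ≤ ℓ + ℓ
      3≤2ℓ = begin
        fromℕ 3                    ≤⟨ log-2^ 3 ⟩
        log (fromℕ 8)
          ≤⟨ log-mono-≤ (0<fromℕ 8 (s≤s z≤n)) (Order.trans (fromℕ-mono-≤ 8≤k*k) (Order.reflexive (×1-homo-* k k))) ⟩
        log (fromℕ k * fromℕ k)    ≈⟨ log-* 0<k 0<k ⟩
        ℓ + ℓ                      ∎
        where
        8≤k*k : 8 ℕ.≤ k ℕ.* k
        8≤k*k = ℕₚ.≤-trans (ℕₚ.n≤1+n 8) (ℕₚ.*-mono-≤ 3≤k 3≤k)

      2≤ℓ² : fromℕ 2 ≤ ℓ * ℓ
      2≤ℓ² with Order.total (fromℕ 2) (ℓ * ℓ)
      ... | inj₁ p = p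
      ... | inj₂ p = contradiction (·-cancelʳ-≤ {9} {8} 0<1 (begin
        fromℕ 9                   ≈⟨ ×1-homo-* 3 3 ⟩
        fromℕ 3 * fromℕ 3         ≤⟨ *-mono-≤ (<⇒≤ (0<fromℕ 3 (s≤s z≤n))) (+-nonNegative 0≤ℓ 0≤ℓ) 3≤2ℓ 3≤2ℓ ⟩
        (ℓ + ℓ) * (ℓ + ℓ)         ≈⟨ square ℓ ⟩
        4 · (ℓ * ℓ)               ≤⟨ ·-monoʳ-≤ 4 p ⟩
        4 · fromℕ 2               ≈⟨ ×-assocˡ 1# 4 2 ⟩
        fromℕ 8                   ∎)) (ℕₚ.n≮n 8)
        where
        square : ∀ x → (x + x) * (x + x) ≈ 4 · (x * x)
        square x = begin-equality
          (x + x) * (x + x)               ≈⟨ Ring.distribˡ (x + x) x x ⟩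
          (x + x) * x + (x + x) * x       ≈⟨ Ring.+-cong (Ring.distribʳ x x x) (Ring.distribʳ x x x) ⟩
          (x * x + x * x) + (x * x + x * x) ≈⟨ Ring.+-assoc _ _ _ ⟩
          x * x + (x * x + (x * x + x * x))
            ≈⟨ Ring.+-congˡ (Ring.+-congˡ (Ring.+-congˡ (Ring.+-identityʳ _))) ⟨
          4 · (x * x)                     ∎

      -- This turns additive constants into multiples of log log k. It rests on `k ≥ 3`: for `k = 2`
      -- the iterated logarithm is 0.
      1≤2λ : 1# ≤ λ′ + λ′
      1≤2λ = begin
        1#              ≈⟨ log-2 ⟨
        log (fromℕ 2)   ≤⟨ log-mono-≤ (0<fromℕ 2 (s≤s z≤n)) 2≤ℓ² ⟩
        log (ℓ * ℓ)     ≈⟨ log-* 0<ℓ 0<ℓ ⟩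
        λ′ + λ′         ∎

      0≤λ : 0# ≤ λ′
      0≤λ = 0≤log 1≤ℓ

      module _ {α} (1≤α : 1# ≤ α) (m A B : ℕ) (m≤ : fromℕ m ≤ ℓ + 1#) (A≤ : fromℕ A ≤ log α + 1#)
        (B≤ : fromℕ B ≤ log (fromℕ (suc m)) + 1#) where

        1+m≤3ℓ : fromℕ (suc m) ≤ 3 · ℓ
        1+m≤3ℓ = begin
          1# + fromℕ m        ≤⟨ +-mono-≤ 1≤ℓ m≤ ⟩
          ℓ + (ℓ + 1#)
            ≤⟨ +-monoʳ-≤ ℓ (+-monoʳ-≤ ℓ (Order.trans 1≤ℓ (Order.reflexive (Ring.sym (Ring.+-identityʳ ℓ))))) ⟩
          3 · ℓ               ∎

        -- The 3 consists of log 4 = 2, from bounding `suc m` by 4ℓ, and of 1 from rounding up.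
        B≤λ+3 : fromℕ B ≤ λ′ + fromℕ 3
        B≤λ+3 = begin
          fromℕ B                           ≤⟨ B≤ ⟩
          log (fromℕ (suc m)) + 1#          ≤⟨ +-monoˡ-≤ 1# (log-mono-≤ (0<fromℕ (suc m) (s≤s z≤n)) 1+m≤4ℓ) ⟩
          log (fromℕ 4 * ℓ) + 1#            ≈⟨ Ring.+-congʳ (log-* 0<4 0<ℓ) ⟩
          log (fromℕ 4) + λ′ + 1#           ≤⟨ +-monoˡ-≤ 1# (+-monoˡ-≤ λ′ log4≤2) ⟩
          fromℕ 2 + λ′ + 1#                 ≈⟨ Ring.+-congʳ (Ring.+-comm _ _) ⟩
          λ′ + fromℕ 2 + 1#                 ≈⟨ Ring.+-assoc _ _ _ ⟩
          λ′ + (fromℕ 2 + 1#)               ≈⟨ Ring.+-congˡ (Ring.+-comm _ _) ⟩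
          λ′ + fromℕ 3                      ∎
          where
          0<4 : 0# < fromℕ 4
          0<4 = 0<fromℕ 4 (s≤s z≤n)
          1+m≤4ℓ : fromℕ (suc m) ≤ fromℕ 4 * ℓ
          1+m≤4ℓ =
            Order.trans 1+m≤3ℓ (Order.trans (·-monoˡ-≤ 0≤ℓ (ℕₚ.n≤1+n 3)) (Order.reflexive (·≈fromℕ* 4 ℓ)))
          log4≤2 : log (fromℕ 4) ≤ fromℕ 2
          log4≤2 = begin
            log (fromℕ 4)                   ≈⟨ log-cong 0<4 (×1-homo-* 2 2) ⟩
            log (fromℕ 2 * fromℕ 2)         ≈⟨ log-* (0<fromℕ 2 (s≤s z≤n)) (0<fromℕ 2 (s≤s z≤n)) ⟩
            log (fromℕ 2) + log (fromℕ 2)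
              ≈⟨ Ring.+-cong log-2 (Ring.trans log-2 (Ring.sym (Ring.+-identityʳ 1#))) ⟩
            fromℕ 2                         ∎

        -- The additive constants 3, 1 and 9 sum to 13, and each unit is at most twice log α + λ′,
        -- whence 27 = 1 + 13 · 2.
        B+A+9≤ : fromℕ (B ℕ.+ A ℕ.+ 9) ≤ 27 · (log α + λ′)
        B+A+9≤ = begin
          fromℕ (B ℕ.+ A ℕ.+ 9)
            ≈⟨ Ring.trans (×-homo-+ 1# (B ℕ.+ A) 9) (Ring.+-congʳ (×-homo-+ 1# B A)) ⟩
          fromℕ B + fromℕ A + fromℕ 9
            ≤⟨ +-monoˡ-≤ (fromℕ 9) (+-mono-≤ B≤λ+3 A≤) ⟩
          λ′ + fromℕ 3 + (log α + 1#) + fromℕ 9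
            ≈⟨ regroup ⟩
          (log α + λ′) + 13 · 1#
            ≤⟨ +-monoʳ-≤ (log α + λ′) (·-monoʳ-≤ 13 (Order.trans 1≤2λ (+-mono-≤ λ≤ λ≤))) ⟩
          (log α + λ′) + 13 · ((log α + λ′) + (log α + λ′))
            ≈⟨ Ring.+-congˡ (Ring.trans (×-congʳ 13 (Ring.+-congˡ (Ring.sym (Ring.+-identityʳ _))))
               (×-assocˡ (log α + λ′) 13 2)) ⟩
          27 · (log α + λ′) ∎
          where
          λ≤ : λ′ ≤ log α + λ′
          λ≤ = x≤y+x (0≤log 1≤α)
          regroup : λ′ + fromℕ 3 + (log α + 1#) + fromℕ 9 ≈ (log α + λ′) + 13 · 1#
          regroup = begin-equality
            λ′ + fromℕ 3 + (log α + 1#) + fromℕ 9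
              ≈⟨ Ring.+-congʳ (Ring.+-congˡ (Ring.+-congˡ (×-homo-1 1#))) ⟨
            λ′ + fromℕ 3 + (log α + fromℕ 1) + fromℕ 9
              ≈⟨ Ring.+-congʳ (interchange λ′ (fromℕ 3) (log α) (fromℕ 1)) ⟩
            λ′ + log α + (fromℕ 3 + fromℕ 1) + fromℕ 9  ≈⟨ Ring.+-assoc _ _ _ ⟩
            λ′ + log α + (fromℕ 3 + fromℕ 1 + fromℕ 9)
              ≈⟨ Ring.+-cong (Ring.+-comm _ _) (Ring.+-congʳ (Ring.sym (×-homo-+ 1# 3 1))) ⟩
            log α + λ′ + (fromℕ 4 + fromℕ 9)            ≈⟨ Ring.+-congˡ (Ring.sym (×-homo-+ 1# 4 9)) ⟩
            log α + λ′ + 13 · 1#                        ∎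

theorem1p1 : (ℝ : RealNumbers) (log : RealNumbers.Carrier ℝ → RealNumbers.Carrier ℝ) → IsLog₂ ℝ log →
    let open RealNumbers ℝ
        open SteinerForest ℝ
    in
    Σ Carrier λ C → 0# < C ×
      ((α : ℕ → Carrier) → (∀ k → 1# ≤ α k) →
       (𝒜 : Greedy) (k : ℕ) → 3 ℕ.≤ k →
       (ℐ : Instance k) (run : Run 𝒜 ℐ) (OPT : Graph (Instance.n ℐ)) → IsOPT ℐ OPT →
       cost ℐ run (pairsBelow ℐ run (α k))
         ≤ C * log (fromℕ k) * (log (α k) + log (log (fromℕ k))) * totalWeight OPT)
theorem1p1 ℝ log isLog₂ = fromℕ (F ℕ.* (3 ℕ.* 27)) , 0<fromℕ (F ℕ.* (3 ℕ.* 27)) 1≤C , bound-by-logs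
  where
  open RealNumbers ℝ
  open SteinerForest ℝ
  open Analysis ℝ
  open Logarithm log isLog₂
  open ≤-Reasoning hiding (stop)

  -- The factor 16κ comes from the total charge and 2 from the mass being at most 2 w(OPT). The
  -- factors 3 and 27 in the final constant come from `1+m≤3ℓ` and `B+A+9≤`.
  F : ℕ
  F = κ ℕ.* 16 ℕ.* 2

  1≤C : 1 ℕ.≤ F ℕ.* (3 ℕ.* 27)
  1≤C = ℕₚ.*-mono-≤ (ℕₚ.*-mono-≤ (ℕₚ.*-mono-≤ 1≤κ (s≤s (z≤n {15}))) (s≤s (z≤n {1}))) (s≤s (z≤n {80}))

  bound-by-logs : (α : ℕ → Carrier) → (∀ k → 1# ≤ α k) → (𝒜 : Greedy) (k : ℕ) → 3 ℕ.≤ k →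
    (ℐ : Instance k) (run : Run 𝒜 ℐ) (OPT : Graph (Instance.n ℐ)) → IsOPT ℐ OPT →
    cost ℐ run (pairsBelow ℐ run (α k))
      ≤ fromℕ (F ℕ.* (3 ℕ.* 27)) * log (fromℕ k) * (log (α k) + log (log (fromℕ k))) * totalWeight OPT
  -- The order is decidable, hence the claimed inequality is stable under double negation, and the
  -- three rounded logarithms may be used although they exist only up to double negation.
  bound-by-logs α 1≤α 𝒜 k 3≤k ℐ run OPT isOPT = decidable-stable (_ Order.≤? _) λ fails →
    ceilLog (1≤fromℕ {k} (ℕₚ.≤-trans (s≤s z≤n) 3≤k)) λ (m , k≤ , m≤) →
    ceilLog (1≤fromℕ {suc m} (s≤s z≤n)) λ (B , 1+m≤ , B≤) →
    ceilLog (1≤α k) λ (A , α≤ , A≤) →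
    fails (conclude m A B k≤ m≤ 1+m≤ B≤ α≤ A≤)
    where
    open LogBounds k 3≤k

    T : Carrier
    T = totalWeight OPT

    0≤T : 0# ≤ T
    0≤T = ∑-nonNegative {f = Edge.weight} Edge.0≤weight OPT

    1≤fromℕ : ∀ {n} → 1 ℕ.≤ n → 1# ≤ fromℕ n
    1≤fromℕ 1≤n = Order.trans (Order.reflexive (Ring.sym (×-homo-1 1#))) (fromℕ-mono-≤ {1} 1≤n)

    conclude : ∀ m A B → fromℕ k ≤ fromℕ (2 ℕ.^ m) → fromℕ m ≤ ℓ + 1# →
      fromℕ (suc m) ≤ fromℕ (2 ℕ.^ B) → fromℕ B ≤ log (fromℕ (suc m)) + 1# →
      α k ≤ fromℕ (2 ℕ.^ A) → fromℕ A ≤ log (α k) + 1# →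
      cost ℐ run (pairsBelow ℐ run (α k)) ≤ fromℕ (F ℕ.* (3 ℕ.* 27)) * ℓ * (log (α k) + λ′) * T
    conclude m A B k≤ m≤ 1+m≤ B≤ α≤ A≤ = begin
      cost ℐ run (pairsBelow ℐ run (α k))
        ≤⟨ Reduction.bound ℐ run OPT isOPT m A B (·-cancelʳ-≤ 0<1 k≤)
             (ℕₚ.≤-trans (·-cancelʳ-≤ 0<1 1+m≤) (2^-mono (ℕₚ.m≤m+n B 3))) α≤ ⟩
      (κ ℕ.* 16 ℕ.* (suc m ℕ.* Q)) · (2 · T)
        ≈⟨ ×-assocˡ T (κ ℕ.* 16 ℕ.* (suc m ℕ.* Q)) 2 ⟩
      (κ ℕ.* 16 ℕ.* (suc m ℕ.* Q) ℕ.* 2) · T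
        ≈⟨ ×-congˡ (regroup (κ ℕ.* 16) (suc m ℕ.* Q)) ⟩
      (F ℕ.* (suc m ℕ.* Q)) · T
        ≈⟨ ·≈fromℕ* (F ℕ.* (suc m ℕ.* Q)) T ⟩
      fromℕ (F ℕ.* (suc m ℕ.* Q)) * T
        ≈⟨ Ring.*-congʳ (Ring.trans (×1-homo-* F (suc m ℕ.* Q)) (Ring.*-congˡ (×1-homo-* (suc m) Q))) ⟩
      fromℕ F * (fromℕ (suc m) * fromℕ Q) * T
        ≤⟨ *-monoʳ-≤ 0≤T (*-monoˡ-≤ (<⇒≤ (0<fromℕ F 1≤F)) (*-mono-≤ (<⇒≤ (0<fromℕ (suc m) (s≤s z≤n)))
             (·-nonNegative 27 (+-nonNegative (0≤log (1≤α k)) 0≤λ)) (1+m≤3ℓ (1≤α k) m A B m≤ A≤ B≤)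
             (B+A+9≤ (1≤α k) m A B m≤ A≤ B≤))) ⟩
      fromℕ F * ((3 · ℓ) * (27 · (log (α k) + λ′))) * T
        ≈⟨ Ring.*-congʳ (Ring.*-congˡ (Ring.*-cong (·≈fromℕ* 3 ℓ) (·≈fromℕ* 27 (log (α k) + λ′)))) ⟩
      fromℕ F * ((fromℕ 3 * ℓ) * (fromℕ 27 * (log (α k) + λ′))) * T
        ≈⟨ Ring.*-congʳ (rearrange (fromℕ F) (fromℕ 3) ℓ (fromℕ 27) (log (α k) + λ′)) ⟩
      fromℕ F * (fromℕ 3 * fromℕ 27) * ℓ * (log (α k) + λ′) * T
        ≈⟨ Ring.*-congʳ (Ring.*-congʳ (Ring.*-congʳ (Ring.trans (×1-homo-* F (3 ℕ.* 27))
             (Ring.*-congˡ (×1-homo-* 3 27))))) ⟨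
      fromℕ (F ℕ.* (3 ℕ.* 27)) * ℓ * (log (α k) + λ′) * T ∎
      where
      Q : ℕ
      Q = B ℕ.+ A ℕ.+ 9
      1≤F : 1 ℕ.≤ F
      1≤F = ℕₚ.*-mono-≤ (ℕₚ.*-mono-≤ 1≤κ (s≤s (z≤n {15}))) (s≤s (z≤n {1}))
      regroup : ∀ x y → x ℕ.* y ℕ.* 2 ≡ x ℕ.* 2 ℕ.* y
      regroup = solve-∀
      rearrange : ∀ f a x b y → f * ((a * x) * (b * y)) ≈ f * (a * b) * x * y
      rearrange = solve 5 (λ f a x b y → f :* ((a :* x) :* (b :* y)) := f :* (a :* b) :* x :* y) Ring.refl
        where
        open SemiringSolver Ring.commutativeSemiring
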